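{- Let $\mathcal F$ be a set of $2$-edge-coloured graphs on three vertices. Suppose that ${}^{rb}P_3\in\mathcal F$ or $\{{}^rP_3,{}^bP_3\}\subseteq\mathcal F$, and that the set of triangles in $\mathcal F$ is $\{{}^rK_3,{}^{rbb}K_3\}$ or $\{{}^bK_3,{}^{rrb}K_3\}$. Then the $\mathcal F$-free colouring problem can be solved via linear equations over $\mathbb Z_2$; that is, from an input graph $G$ one can construct in polynomial time a system of linear equations over $\mathbb Z_2$ that is solvable if and only if $G$ admits an $\mathcal F$-free $2$-edge-colouring.
   Context: Graphs are finite and simple. A $2$-edge-colouring of $G$ assigns to every edge the colour red or blue (not necessarily properly). For a set $\mathcal F$ of $2$-edge-coloured graphs, a $2$-edge-colouring of $G$ is $\mathcal F$-free if no induced $2$-edge-coloured subgraph is isomorphic (preserving colours) to a member of $\mathcal F$. The $\mathcal F$-free colouring problem is to decide whether an input graph $G$ admits an $\mathcal F$-free $2$-edge-colouring. The $2$-edge-coloured graphs on three vertices are: the edgeless graph $3K_1$; the one-edge graph with a red or with a blue edge; ${}^rP_3$, ${}^bP_3$, ${}^{rb}P_3$, the path on three vertices with both edges red, both edges blue, or one edge of each colour; ${}^rK_3$, ${}^bK_3$, ${}^{rrb}K_3$, ${}^{rbb}K_3$, the triangle with all edges red, all edges blue, two red and one blue, or one red and two blue edges, respectively. -}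

module Defs where

open import Data.Bool using (Bool; true; false; T; if_then_else_)
open import Data.Fin using (Fin; zero; suc)
open import Data.List using (List; []; _∷_; _++_; _∷ʳ_; length; replicate; concat; concatMap; tabulate; map)
open import Data.List.Relation.Unary.All using (All)
open import Data.List.Relation.Unary.Any using (Any)
open import Data.Nat using (ℕ; zero; suc; _+_; _∸_; _*_; _^_; _≤_; _≡ᵇ_)
open import Data.Parity using (Parity; 0ℙ; 1ℙ) renaming (_+_ to _+ℙ_; _*_ to _*ℙ_)
open import Data.Product using (Σ; ∃; ∃-syntax; _×_; _,_)
open import Data.Vec as Vec using (Vec)
open import Function using (_↔_; _↣_; _⇔_; Injection; Inverse)
open import Relation.Binary.PropositionalEquality using (_≡_; _≢_; refl)
open import Relation.Nullary using (¬_)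

record Graph (n : ℕ) : Set where
  field
    adj      : Fin n → Fin n → Bool
    adj-sym  : ∀ u v → adj u v ≡ adj v u
    loopless : ∀ u → adj u u ≡ false

  Adj : Fin n → Fin n → Set
  Adj u v = T (adj u v)

open Graph public

data Colour : Set where
  red blue : Colour

record Colouring {n : ℕ} (G : Graph n) : Set where
  field
    colour     : ∀ u v → Adj G u v → Colour
    colour-sym : ∀ u v (p : Adj G u v) (q : Adj G v u) → colour u v p ≡ colour v u q

open Colouring public

record ColouredGraph (n : ℕ) : Set where
  constructor _,_
  field
    graph     : Graph n
    colouring : Colouring graph

open ColouredGraph public

record _≅_ {m n : ℕ} (H : ColouredGraph m) (K : ColouredGraph n) : Set where
  field
    bijection : Fin m ↔ Fin n

  open Inverse bijection using (to)

  field
    adj-preserved    : ∀ u v → adj (graph H) u v ≡ adj (graph K) (to u) (to v)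
    colour-preserved : ∀ u v (p : Adj (graph H) u v) (q : Adj (graph K) (to u) (to v)) →
                       colour (colouring H) u v p ≡ colour (colouring K) (to u) (to v) q

-- The subgraph induced by the image of ι, with its vertices named by Fin m.
induced : ∀ {m n} → ColouredGraph n → Fin m ↣ Fin n → ColouredGraph m
induced (G , c) ι = record
  { adj      = λ u v → adj G (to u) (to v)
  ; adj-sym  = λ u v → adj-sym G (to u) (to v)
  ; loopless = λ u → loopless G (to u)
  } , record
  { colour     = λ u v → colour c (to u) (to v)
  ; colour-sym = λ u v → colour-sym c (to u) (to v)
  }
  where open Injection ι using (to)

-- There are finitely many coloured graphs on k vertices up to isomorphism, so
-- a set of them is given by a list, with membership taken up to isomorphism.
_∈≅_ : ∀ {m k} → ColouredGraph m → List (ColouredGraph k) → Set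
H ∈≅ F = Any (H ≅_) F

Free : ∀ {k n} → List (ColouredGraph k) → ColouredGraph n → Set
Free {n = n} F G = ∀ {m} (ι : Fin m ↣ Fin n) → ¬ (induced G ι ∈≅ F)

HasFreeColouring : ∀ {k n} → List (ColouredGraph k) → Graph n → Set
HasFreeColouring F G = Σ (Colouring G) λ c → Free F (G , c)

-- The symmetric 3 × 3 table with diagonal d and entries x₀₁, x₁₂, x₀₂.
table : {A : Set} (d x₀₁ x₁₂ x₀₂ : A) → Fin 3 → Fin 3 → A
table d x y z zero             zero             = d
table d x y z zero             (suc zero)       = x
table d x y z zero             (suc (suc zero)) = z
table d x y z (suc zero)       zero             = x
table d x y z (suc zero)       (suc zero)       = d
table d x y z (suc zero)       (suc (suc zero)) = y
table d x y z (suc (suc zero)) zero             = z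
table d x y z (suc (suc zero)) (suc zero)       = y
table d x y z (suc (suc zero)) (suc (suc zero)) = d

table-sym : {A : Set} (d x y z : A) → ∀ u v → table d x y z u v ≡ table d x y z v u
table-sym d x y z zero             zero             = refl
table-sym d x y z zero             (suc zero)       = refl
table-sym d x y z zero             (suc (suc zero)) = refl
table-sym d x y z (suc zero)       zero             = refl
table-sym d x y z (suc zero)       (suc zero)       = refl
table-sym d x y z (suc zero)       (suc (suc zero)) = refl
table-sym d x y z (suc (suc zero)) zero             = refl
table-sym d x y z (suc (suc zero)) (suc zero)       = refl
table-sym d x y z (suc (suc zero)) (suc (suc zero)) = refl

table-diag : {A : Set} (d x y z : A) → ∀ u → table d x y z u u ≡ d
table-diag d x y z zero             = refl
table-diag d x y z (suc zero)       = refl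
table-diag d x y z (suc (suc zero)) = refl

graph₃ : (e₀₁ e₁₂ e₀₂ : Bool) → Graph 3
graph₃ x y z = record
  { adj      = table false x y z
  ; adj-sym  = table-sym false x y z
  ; loopless = table-diag false x y z
  }

colouring₃ : (G : Graph 3) (c₀₁ c₁₂ c₀₂ : Colour) → Colouring G
colouring₃ G x y z = record
  { colour     = λ u v _ → table red x y z u v
  ; colour-sym = λ u v _ _ → table-sym red x y z u v
  }

-- The path 0 – 1 – 2; the colour given for the non-edge 02 is never used.
path : (c₀₁ c₁₂ : Colour) → ColouredGraph 3
path x y = graph₃ true true false , colouring₃ _ x y red

triangle : (c₀₁ c₁₂ c₀₂ : Colour) → ColouredGraph 3
triangle x y z = graph₃ true true true , colouring₃ _ x y z

rP₃ bP₃ rbP₃ : ColouredGraph 3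
rP₃  = path red red
bP₃  = path blue blue
rbP₃ = path red blue

rK₃ bK₃ rrbK₃ rbbK₃ : ColouredGraph 3
rK₃   = triangle red red red
bK₃   = triangle blue blue blue
rrbK₃ = triangle red red blue
rbbK₃ = triangle red blue blue

IsTriangle : ColouredGraph 3 → Set
IsTriangle H = ∀ u v → u ≢ v → Adj (graph H) u v

TrianglesOf_Are_ : (F 𝒯 : List (ColouredGraph 3)) → Set
TrianglesOf F Are 𝒯 = ∀ H → IsTriangle H → (H ∈≅ F ⇔ H ∈≅ 𝒯)

-- ℤ₂ is the field Parity.
record Equation (m : ℕ) : Set where
  constructor _≐_
  field
    coefficients : Vec Parity m
    constant     : Parity

record LinearSystem : Set where
  field
    variables : ℕ
    equations : List (Equation variables)

open LinearSystem public

_·_ : ∀ {m} → Vec Parity m → Vec Parity m → Parity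
a · x = Vec.foldr′ _+ℙ_ 0ℙ (Vec.zipWith _*ℙ_ a x)

_Satisfies_ : ∀ {m} → Vec Parity m → Equation m → Set
x Satisfies (a ≐ b) = a · x ≡ b

Solvable : LinearSystem → Set
Solvable S = ∃[ x ] All (x Satisfies_) (equations S)

Word : Set
Word = List Bool

-- 1ⁿ0 followed by the rows of the adjacency matrix.
encodeGraph : ∃ Graph → Word
encodeGraph (n , G) =
  replicate n true ++ false ∷ concat (tabulate λ u → tabulate λ v → adj G u v)

encodeParity : Parity → Bool
encodeParity 0ℙ = false
encodeParity 1ℙ = true

encodeEquation : ∀ {m} → Equation m → Word
encodeEquation (a ≐ b) = map encodeParity (Vec.toList a ∷ʳ b)

-- 1ᵐ0 for m variables, followed by the rows of the augmented matrix.  Each row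
-- has length m + 1, so the word determines the system.
encodeSystem : LinearSystem → Word
encodeSystem S = replicate (variables S) true ++ false ∷ concatMap encodeEquation (equations S)

-- Structured programs for a unit-cost random access machine whose only
-- arithmetic is addition and truncated subtraction.  Apart from loading one of
-- the program's constants, a step lengthens the largest stored number by at most
-- one bit, so a Turing machine simulates a run of t steps in time polynomial in
-- t and the length of the input.

Reg : Set
Reg = ℕ

data Program : Set where
  skip                : Program
  const               : (target : Reg) (value : ℕ) → Program
  add sub             : (target left right : Reg) → Program
  load                : (target address : Reg) → Program
  store               : (address source : Reg) → Program
  print               : Bool → Program
  _⨾_                 : Program → Program → Program
  ifPos_then_else_    : Reg → Program → Program → Program
  whilePos_repeat_    : Reg → Program → Program

infixr 5 _⨾_

record State : Set where
  constructor state
  field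
    register : Reg → ℕ
    memory   : ℕ → ℕ
    output   : Word

open State public

_[_≔_] : (ℕ → ℕ) → ℕ → ℕ → (ℕ → ℕ)
(f [ i ≔ x ]) j = if i ≡ᵇ j then x else f j

setReg : Reg → ℕ → State → State
setReg r x (state ρ μ o) = state (ρ [ r ≔ x ]) μ o

-- ⟨ P , σ ⟩⇓[ t ] σ′ : started in σ, P halts in σ′ after t steps.
data ⟨_,_⟩⇓[_]_ : Program → State → ℕ → State → Set where
  ⇓skip  : ∀ {σ} → ⟨ skip , σ ⟩⇓[ 1 ] σ
  ⇓const : ∀ {r k σ} → ⟨ const r k , σ ⟩⇓[ 1 ] setReg r k σ
  ⇓add   : ∀ {r s t σ} → ⟨ add r s t , σ ⟩⇓[ 1 ] setReg r (register σ s + register σ t) σ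
  ⇓sub   : ∀ {r s t σ} → ⟨ sub r s t , σ ⟩⇓[ 1 ] setReg r (register σ s ∸ register σ t) σ
  ⇓load  : ∀ {r s σ} → ⟨ load r s , σ ⟩⇓[ 1 ] setReg r (memory σ (register σ s)) σ
  ⇓store : ∀ {r s ρ μ o} →
           ⟨ store r s , state ρ μ o ⟩⇓[ 1 ] state ρ (μ [ ρ r ≔ ρ s ]) o
  ⇓print : ∀ {b ρ μ o} → ⟨ print b , state ρ μ o ⟩⇓[ 1 ] state ρ μ (o ∷ʳ b)
  ⇓seq   : ∀ {P Q σ σ′ σ″ t t′} →
           ⟨ P , σ ⟩⇓[ t ] σ′ → ⟨ Q , σ′ ⟩⇓[ t′ ] σ″ → ⟨ P ⨾ Q , σ ⟩⇓[ t + t′ ] σ″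
  ⇓then  : ∀ {r P Q σ σ′ t} → register σ r ≢ 0 →
           ⟨ P , σ ⟩⇓[ t ] σ′ → ⟨ ifPos r then P else Q , σ ⟩⇓[ suc t ] σ′
  ⇓else  : ∀ {r P Q σ σ′ t} → register σ r ≡ 0 →
           ⟨ Q , σ ⟩⇓[ t ] σ′ → ⟨ ifPos r then P else Q , σ ⟩⇓[ suc t ] σ′
  ⇓exit  : ∀ {r P σ} → register σ r ≡ 0 → ⟨ whilePos r repeat P , σ ⟩⇓[ 1 ] σ
  ⇓loop  : ∀ {r P σ σ′ σ″ t t′} → register σ r ≢ 0 →
           ⟨ P , σ ⟩⇓[ t ] σ′ → ⟨ whilePos r repeat P , σ′ ⟩⇓[ t′ ] σ″ →
           ⟨ whilePos r repeat P , σ ⟩⇓[ suc (t + t′) ] σ″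

contents : Word → ℕ → ℕ
contents []          _       = 0
contents (true  ∷ w) zero    = 1
contents (false ∷ w) zero    = 0
contents (_     ∷ w) (suc i) = contents w i

-- Memory cell i holds the i-th input bit and register 0 the input length.
initial : Word → State
initial w = state ((λ _ → 0) [ 0 ≔ length w ]) (contents w) []

PolynomialTime : {A B : Set} → (A → Word) → (B → Word) → (A → B) → Set
PolynomialTime encA encB f =
  ∃[ P ] ∃[ c ] ∃[ d ] ∀ x → ∃[ t ] ∃[ σ ]
    ⟨ P , initial (encA x) ⟩⇓[ t ] σ ×
    output σ ≡ encB (f x) ×
    t ≤ c * suc (length (encA x)) ^ d

{-# OPTIONS --safe #-}

-- With red = 1, the hypotheses make the permitted colourings of every induced
-- subgraph on three vertices an affine subspace of ℤ₂³, and a colouring is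
-- F-free exactly when it is permitted on every triple of vertices: an even (or
-- odd) number of red edges on triangles, equal (or different) colours on induced
-- paths, and possibly single edges or triples excluded altogether.
--
-- For the polynomial time bound, the system is written by a program in a small
-- language whose only loops are counting loops.  Every program of this language
-- runs in polynomial time, so that only its output has to be determined.

module Submission where

open import Defs
open import Data.Bool using (Bool; true; false; T; if_then_else_)
open import Data.Empty using (⊥-elim)
open import Data.Fin using (Fin; zero; suc; toℕ; fromℕ<; combine; remQuot)
open import Data.Fin.Patterns
open import Data.Fin.Permutation using (↔⇒≡; transpose; _⟨$⟩ʳ_)
import Data.Fin.Properties as Fin
open import Data.Fin.Properties using (toℕ<n; toℕ-injective; toℕ-fromℕ<)
open import Data.List using (List; []; _∷_; _++_; [_]; _∷ʳ_; concat; concatMap; downFrom; length; replicate; map; foldr; tabulate)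
open import Data.List.Properties using (++-assoc; ++-identityʳ; concatMap-++; concatMap-cong; length-++; length-replicate; length-tabulate; map-∘; map-cong)
open import Data.List.Relation.Unary.All as All using (All; []; _∷_)
open import Data.List.Relation.Unary.All.Properties using (++⁺; ++⁻ˡ; ++⁻ʳ)
open import Data.List.Relation.Unary.Any as Any using (Any)
open import Data.Maybe using (Maybe; just; nothing; is-just; fromMaybe; maybe′)
open import Data.Maybe.Properties using (just-injective; ≡-dec)
open import Data.Nat hiding (parity)
open import Data.Nat.Properties
open import Data.Parity using (Parity; 0ℙ; 1ℙ; _⁻¹) renaming (_+_ to _+ℙ_; _*_ to _*ℙ_)
import Data.Parity.Properties as ℙ
open import Data.Product using (Σ; ∃; _×_; _,_; proj₁; proj₂; uncurry)
open import Data.Sum using (_⊎_; inj₁; inj₂)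
open import Data.Unit using (⊤; tt)
open import Data.Vec as Vec using (Vec; []; _∷_; lookup)
open import Data.Vec.Properties using (lookup∘tabulate)
open import Function using (_∘_; _⇔_; mk⇔; Equivalence; _↔_; mk↔ₛ′; Inverse; Injection; mk↣)
open import Function.Construct.Composition using (_↔-∘_)
open import Function.Construct.Identity using (↔-id)
open import Function.Construct.Symmetry using (↔-sym)
open import Relation.Binary using (DecidableEquality)
open import Relation.Binary.PropositionalEquality hiding ([_])
open import Relation.Nullary using (¬_; Dec; yes; no; does)
open import Relation.Nullary.Decidable using (map′; _×-dec_; ¬?; decidable-stable)

open Equivalence using (to; from)

-- A language of counting loops

infixl 6 _⊕_
infixl 7 _⊗_

-- The hypothesis on paths excludes the one non-affine case: if only `rP₃` or only `bP₃` were
-- forbidden among the paths, three of the four colourings of a path would survive, and three points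
-- of ℤ₂² form no affine subspace. There is one variable per ordered pair of vertices, diagonal and
-- non-edges included. The number n * u + v of a variable is then also the offset of the matrix
-- entry in the input, so edges need not be numbered. The price is an equation identifying the
-- variables of uv and vu; variables of non-edges occur in no other equation. The equations for a
-- triple depend only on F and three adjacency bits. Membership in F is therefore decided while the
-- program is built, and the running program merely reads bits. Counting loops run in polynomial
-- time because variables are never reassigned and memory is only read: each loop bound is an
-- expression in the enclosing variables, hence polynomial, and the nesting depth is fixed by the
-- syntax.

data Exp (k : ℕ) : Set where
  var     : Fin k → Exp k
  lit     : ℕ → Exp k
  _⊕_ _⊗_ : Exp k → Exp k → Exp k
  mem     : Exp k → Exp k

infixr 5 _▸_

-- The emitted items `X` may mention the variables in scope. The same loops can thus emit rows of
-- expressions, which are easy to reason about, and later be expanded to emit bits.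
data Code (X : ℕ → Set) (k : ℕ) : Set where
  stop : Code X k
  emit : X k → Code X k
  _▸_  : Code X k → Code X k → Code X k
  ifEq : Exp k → Exp k → Code X k → Code X k → Code X k
  for  : Exp k → Code X (suc k) → Code X k

eval : ∀ {k} → (ℕ → ℕ) → Exp k → Vec ℕ k → ℕ
eval μ (var i) env = lookup env i
eval μ (lit c) env = c
eval μ (e ⊕ f) env = eval μ e env + eval μ f env
-- The factors are exchanged because the compiled loop adds `e` as often as `f` says; this also
-- makes `i ⊗ n ⊕ j` evaluate to n * i + j.
eval μ (e ⊗ f) env = eval μ f env * eval μ e env
eval μ (mem e) env = μ (eval μ e env)

run : {X : ℕ → Set} {A : Set} → (ℕ → ℕ) → (∀ {k} → X k → Vec ℕ k → A) →
      ∀ {k} → Code X k → Vec ℕ k → List A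
run μ g stop           env = []
run μ g (emit x)       env = [ g x env ]
run μ g (P ▸ Q)        env = run μ g P env ++ run μ g Q env
run μ g (ifEq e f P Q) env =
  if eval μ e env ≡ᵇ eval μ f env then run μ g P env else run μ g Q env
run μ g (for e P)      env = concatMap (λ j → run μ g P (j ∷ env)) (downFrom (eval μ e env))

Bits : ℕ → Set
Bits k = Bool

word : ∀ {k} → (ℕ → ℕ) → Code Bits k → Vec ℕ k → Word
word μ = run μ (λ b _ → b)

-- The variables of a context of length k live in the registers below k, the
-- innermost one in register k - 1, so that code in this context may overwrite
-- every register from k on.
reg : ∀ {k} → Fin k → Reg
reg {suc k} zero    = k
reg {suc k} (suc i) = reg i

compileExp : ∀ {k} → Reg → Exp k → Program
compileExp r (var i) = const r 0 ⨾ add r (reg i) r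
compileExp r (lit c) = const r c
compileExp r (e ⊕ f) = compileExp r e ⨾ compileExp (1 + r) f ⨾ add r r (1 + r)
compileExp r (e ⊗ f) =
  compileExp (1 + r) e ⨾ compileExp (2 + r) f ⨾ const r 0 ⨾
  whilePos 2 + r repeat (const (3 + r) 1 ⨾ sub (2 + r) (2 + r) (3 + r) ⨾ add r r (1 + r))
compileExp r (mem e) = compileExp r e ⨾ load r r

compile : ∀ {k} → Code Bits k → Program
compile stop               = skip
compile (emit b)           = print b
compile (P ▸ Q)            = compile P ⨾ compile Q
-- The sum of the two truncated differences is the distance of the values, positive exactly when
-- they differ; hence `Q` is the first branch.
compile {k} (ifEq e f P Q) =
  compileExp k e ⨾ compileExp (1 + k) f ⨾
  sub (2 + k) k (1 + k) ⨾ sub k (1 + k) k ⨾ add k k (2 + k) ⨾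
  ifPos k then compile Q else compile P
-- The counter is decremented before the body, so that register `k` holds the current index during
-- it; the last index is 0.
compile {k} (for e P)      =
  compileExp k e ⨾ whilePos k repeat (const (1 + k) 1 ⨾ sub k k (1 + k) ⨾ compile P)

-- Values and times are bounded by powers of one base N ≥ 2; the exponents below
-- do not depend on N.  Here δ is an exponent for the values of the variables and
-- N ^ a + N ^ b ≤ N ^ (a ⊹ b).
infixr 6 _⊹_

_⊹_ : ℕ → ℕ → ℕ
a ⊹ b = suc (a + b)

valueDegree : ∀ {k} → ℕ → Exp k → ℕ
valueDegree δ (var i) = δ
valueDegree δ (lit c) = c
valueDegree δ (e ⊕ f) = valueDegree δ e ⊹ valueDegree δ f
valueDegree δ (e ⊗ f) = valueDegree δ f + valueDegree δ e
valueDegree δ (mem e) = 0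

expDegree : ∀ {k} → ℕ → Exp k → ℕ
expDegree δ (var i) = 1
expDegree δ (lit c) = 0
expDegree δ (e ⊕ f) = expDegree δ e ⊹ expDegree δ f ⊹ 0
expDegree δ (e ⊗ f) = expDegree δ e ⊹ expDegree δ f ⊹ 1 ⊹ (valueDegree δ f + 2)
expDegree δ (mem e) = expDegree δ e ⊹ 0

codeDegree : ∀ {k} → ℕ → Code Bits k → ℕ
codeDegree δ stop           = 0
codeDegree δ (emit b)       = 0
codeDegree δ (P ▸ Q)        = codeDegree δ P ⊹ codeDegree δ Q
codeDegree δ (ifEq e f P Q) = expDegree δ e ⊹ expDegree δ f ⊹ 2 ⊹ codeDegree δ P ⊹ codeDegree δ Q
-- The index is below the value of `e`, so the enlarged δ bounds it together with the older
-- variables. The 0 pays for the final test, the 2 for three control steps per round.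
codeDegree δ (for e P)      =
  expDegree δ e ⊹ 0 ⊹ (valueDegree δ e + (2 ⊹ codeDegree (δ + valueDegree δ e) P))

-- Registers and the environments they hold

≡ᵇ-refl : ∀ n → (n ≡ᵇ n) ≡ true
≡ᵇ-refl zero    = refl
≡ᵇ-refl (suc n) = ≡ᵇ-refl n

≢⇒≡ᵇ : ∀ {m n} → m ≢ n → (m ≡ᵇ n) ≡ false
≢⇒≡ᵇ {m} {n} m≢n with m ≡ᵇ n in eq
... | false = refl
... | true  = ⊥-elim (m≢n (≡ᵇ⇒≡ m n (subst T (sym eq) _)))

≔-same : ∀ ρ r x → (ρ [ r ≔ x ]) r ≡ x
≔-same ρ r x rewrite ≡ᵇ-refl r = refl

≔-other : ∀ ρ {r s} x → r ≢ s → (ρ [ r ≔ x ]) s ≡ ρ s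
≔-other ρ x r≢s rewrite ≢⇒≡ᵇ r≢s = refl

reg<k : ∀ {k} (i : Fin k) → reg i < k
reg<k {suc k} zero    = ≤-refl
reg<k {suc k} (suc i) = m≤n⇒m≤1+n (reg<k i)

infix 4 _⊨_ _≗[_]_

_⊨_ : ∀ {k} → (Reg → ℕ) → Vec ℕ k → Set
ρ ⊨ env = ∀ i → ρ (reg i) ≡ lookup env i

-- The frame condition: registers below `k`, which hold enclosing variables and pending operands,
-- survive a computation.
_≗[_]_ : (Reg → ℕ) → ℕ → (Reg → ℕ) → Set
ρ ≗[ k ] ρ′ = ∀ {s} → s < k → ρ s ≡ ρ′ s

≗-trans : ∀ {k ρ ρ′ ρ″} → ρ ≗[ k ] ρ′ → ρ′ ≗[ k ] ρ″ → ρ ≗[ k ] ρ″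
≗-trans p q s<k = trans (p s<k) (q s<k)

≗-weaken : ∀ {k l ρ ρ′} → k ≤ l → ρ ≗[ l ] ρ′ → ρ ≗[ k ] ρ′
≗-weaken k≤l p s<k = p (<-≤-trans s<k k≤l)

≗-≔ : ∀ {k r x} ρ → k ≤ r → ρ [ r ≔ x ] ≗[ k ] ρ
≗-≔ {x = x} ρ k≤r s<k = ≔-other ρ x (≢-sym (<⇒≢ (<-≤-trans s<k k≤r)))

⊨-≗ : ∀ {k l ρ ρ′} {env : Vec ℕ k} → k ≤ l → ρ′ ≗[ l ] ρ → ρ ⊨ env → ρ′ ⊨ env
⊨-≗ k≤l p ρ⊨ i = trans (p (<-≤-trans (reg<k i) k≤l)) (ρ⊨ i)

-- Correctness and running time of compiled code

module Compilation {N : ℕ} (2≤N : 2 ≤ N) {μ : ℕ → ℕ} (μ≤1 : ∀ i → μ i ≤ 1) where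

  1≤N^ : ∀ a → 1 ≤ N ^ a
  1≤N^ a = m^n>0 N {{>-nonZero (<-trans z<s 2≤N)}} a

  N^-mono : ∀ {a b} → a ≤ b → N ^ a ≤ N ^ b
  N^-mono = ^-monoʳ-≤ N {{>-nonZero (<-trans z<s 2≤N)}}

  2≤N^1 : 2 ≤ N ^ 1
  2≤N^1 = subst (2 ≤_) (sym (*-identityʳ N)) 2≤N

  4≤N^2 : 4 ≤ N ^ 2
  4≤N^2 = *-mono-≤ 2≤N 2≤N^1

  *-bound : ∀ {x y} a b → x ≤ N ^ a → y ≤ N ^ b → x * y ≤ N ^ (a + b)
  *-bound a b p q = ≤-trans (*-mono-≤ p q) (≤-reflexive (sym (^-distribˡ-+-* N a b)))

  +-bound : ∀ {x y} a b → x ≤ N ^ a → y ≤ N ^ b → x + y ≤ N ^ (a ⊹ b)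
  +-bound {x} {y} a b p q = begin
    x + y                         ≤⟨ +-mono-≤ (≤-trans p (N^-mono (m≤m+n a b)))
                                              (≤-trans q (N^-mono (m≤n+m b a))) ⟩
    N ^ (a + b) + N ^ (a + b)     ≡⟨ cong (N ^ (a + b) +_) (sym (+-identityʳ _)) ⟩
    2 * N ^ (a + b)               ≤⟨ *-monoˡ-≤ (N ^ (a + b)) 2≤N ⟩
    N ^ (a ⊹ b)                   ∎
    where open ≤-Reasoning

  n≤N^n : ∀ n → n ≤ N ^ n
  n≤N^n zero    = z≤n
  n≤N^n (suc n) = ≤-trans (+-bound 0 n ≤-refl (n≤N^n n)) ≤-refl

  Bounded : ∀ {k} → ℕ → Vec ℕ k → Set
  Bounded δ env = ∀ i → lookup env i ≤ N ^ δ

  value-bound : ∀ {k δ} {env : Vec ℕ k} → Bounded δ env → ∀ e → eval μ e env ≤ N ^ valueDegree δ e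
  value-bound {env = env} env≤ (var i) = env≤ i
  value-bound {env = env} env≤ (lit c) = n≤N^n c
  value-bound {δ = δ} {env} env≤ (e ⊕ f) =
    +-bound (valueDegree δ e) (valueDegree δ f) (value-bound {env = env} env≤ e) (value-bound {env = env} env≤ f)
  value-bound {δ = δ} {env} env≤ (e ⊗ f) =
    *-bound (valueDegree δ f) (valueDegree δ e) (value-bound {env = env} env≤ f) (value-bound {env = env} env≤ e)
  value-bound {env = env} env≤ (mem e) = μ≤1 _

  -- Induction on the counter needs an accumulator with arbitrary start value, whence the summand
  -- `ρ r`. A round costs four steps: the test and three instructions.
  multiply : ∀ r c ρ → ρ (2 + r) ≡ c → ∃ λ ρ′ →
    (∀ {o} →
      ⟨ whilePos 2 + r repeat (const (3 + r) 1 ⨾ sub (2 + r) (2 + r) (3 + r) ⨾ add r r (1 + r))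
      , state ρ μ o ⟩⇓[ 1 + c * 4 ] state ρ′ μ o) ×
    ρ′ ≗[ r ] ρ × ρ′ r ≡ c * ρ (1 + r) + ρ r
  multiply r zero    ρ eq = ρ , ⇓exit eq , (λ _ → refl) , refl
  multiply r (suc c) ρ eq =
    let ρ′ , exec , same , val = multiply r c ρ₃ ρ₃-count in
      ρ′ , ⇓loop (λ z → 0≢1+n (trans (sym z) eq)) (⇓seq ⇓const (⇓seq ⇓sub ⇓add)) exec
    , ≗-trans same ρ₃≗ρ
    , (begin
        ρ′ r                              ≡⟨ val ⟩
        c * ρ₃ (1 + r) + ρ₃ r             ≡⟨ cong₂ (λ x y → c * x + y) ρ₃-step ρ₃-acc ⟩
        c * ρ (1 + r) + (ρ r + ρ (1 + r)) ≡⟨ cong (c * ρ (1 + r) +_) (+-comm (ρ r) _) ⟩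
        c * ρ (1 + r) + (ρ (1 + r) + ρ r) ≡⟨ sym (+-assoc (c * ρ (1 + r)) _ _) ⟩
        c * ρ (1 + r) + ρ (1 + r) + ρ r   ≡⟨ cong (_+ ρ r) (+-comm (c * ρ (1 + r)) _) ⟩
        suc c * ρ (1 + r) + ρ r           ∎)
    where
    open ≡-Reasoning
    ρ₁ ρ₂ ρ₃ : Reg → ℕ
    ρ₁ = ρ [ 3 + r ≔ 1 ]
    ρ₂ = ρ₁ [ 2 + r ≔ ρ₁ (2 + r) ∸ ρ₁ (3 + r) ]
    ρ₃ = ρ₂ [ r ≔ ρ₂ r + ρ₂ (1 + r) ]
    ρ₃≗ρ : ρ₃ ≗[ r ] ρ
    ρ₃≗ρ = ≗-trans (≗-≔ ρ₂ ≤-refl) (≗-trans (≗-≔ ρ₁ (m≤n+m r 2)) (≗-≔ ρ (m≤n+m r 3)))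
    ρ₂≗ρ : ρ₂ ≗[ 2 + r ] ρ
    ρ₂≗ρ = ≗-trans (≗-≔ ρ₁ ≤-refl) (≗-≔ ρ (n≤1+n _))
    ρ₃-count : ρ₃ (2 + r) ≡ c
    ρ₃-count = begin
      ρ₃ (2 + r)                  ≡⟨ ≔-other ρ₂ _ (<⇒≢ (m≤n+m (suc r) 1)) ⟩
      ρ₂ (2 + r)                  ≡⟨ ≔-same ρ₁ (2 + r) _ ⟩
      ρ₁ (2 + r) ∸ ρ₁ (3 + r)     ≡⟨ cong₂ _∸_ (≗-≔ ρ ≤-refl ≤-refl) (≔-same ρ (3 + r) 1) ⟩
      ρ (2 + r) ∸ 1               ≡⟨ cong (_∸ 1) eq ⟩
      c                           ∎
    ρ₃-step : ρ₃ (1 + r) ≡ ρ (1 + r)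
    ρ₃-step = trans (≔-other ρ₂ {r} _ (<⇒≢ ≤-refl)) (ρ₂≗ρ ≤-refl)
    ρ₃-acc : ρ₃ r ≡ ρ r + ρ (1 + r)
    ρ₃-acc = trans (≔-same ρ₂ r _) (cong₂ _+_ (ρ₂≗ρ (m≤n+m (suc r) 1)) (ρ₂≗ρ ≤-refl))

  -- The target `r` may lie above `k`, since registers from `k` to below `r` can hold operands
  -- computed earlier; the frame condition at `r` protects them along with the variables.
  compileExp-correct : ∀ {k δ} {env : Vec ℕ k} → Bounded δ env → ∀ e {r} → k ≤ r →
    ∀ {ρ} → ρ ⊨ env → ∃ λ t → ∃ λ ρ′ →
    (∀ {o} → ⟨ compileExp r e , state ρ μ o ⟩⇓[ t ] state ρ′ μ o) ×
    t ≤ N ^ expDegree δ e × ρ′ ≗[ r ] ρ × ρ′ r ≡ eval μ e env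
  compileExp-correct {env = env} env≤ (var i) {r} k≤r {ρ} ρ⊨ =
    2 , _ , ⇓seq ⇓const ⇓add , 2≤N^1 , ≗-trans (≗-≔ ρ₁ ≤-refl) (≗-≔ ρ ≤-refl) , (begin
      (ρ₁ [ r ≔ ρ₁ (reg i) + ρ₁ r ]) r ≡⟨ ≔-same ρ₁ r _ ⟩
      ρ₁ (reg i) + ρ₁ r                ≡⟨ cong₂ _+_ (≗-≔ ρ ≤-refl (<-≤-trans (reg<k i) k≤r)) (≔-same ρ r 0) ⟩
      ρ (reg i) + 0                    ≡⟨ +-identityʳ _ ⟩
      ρ (reg i)                        ≡⟨ ρ⊨ i ⟩
      lookup env i                     ∎)
    where
    open ≡-Reasoning
    ρ₁ : Reg → ℕ
    ρ₁ = ρ [ r ≔ 0 ]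
  compileExp-correct {env = env} env≤ (lit c) {r} k≤r {ρ} ρ⊨ =
    1 , _ , ⇓const , ≤-refl , ≗-≔ ρ ≤-refl , ≔-same ρ r c
  compileExp-correct {δ = δ} {env} env≤ (e ⊕ f) {r} k≤r {ρ} ρ⊨
    with t₁ , ρ₁ , exec₁ , time₁ , same₁ , val₁ ← compileExp-correct {env = env} env≤ e k≤r ρ⊨
    with t₂ , ρ₂ , exec₂ , time₂ , same₂ , val₂ ← compileExp-correct {env = env} env≤ f (m≤n⇒m≤1+n k≤r) (⊨-≗ {env = env} k≤r same₁ ρ⊨)
    = _ , _ , ⇓seq exec₁ (⇓seq exec₂ ⇓add)
    , +-bound (expDegree δ e) (expDegree δ f ⊹ 0) time₁ (+-bound (expDegree δ f) 0 time₂ ≤-refl)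
    , ≗-trans (≗-≔ ρ₂ ≤-refl) (≗-trans (≗-weaken (n≤1+n r) same₂) same₁)
    , trans (≔-same ρ₂ r _) (cong₂ _+_ (trans (same₂ ≤-refl) val₁) val₂)
  compileExp-correct {δ = δ} {env} env≤ (e ⊗ f) {r} k≤r {ρ} ρ⊨
    with t₁ , ρ₁ , exec₁ , time₁ , same₁ , val₁ ← compileExp-correct {env = env} env≤ e (m≤n⇒m≤1+n k≤r) ρ⊨
    with t₂ , ρ₂ , exec₂ , time₂ , same₂ , val₂ ← compileExp-correct {env = env} env≤ f (m≤n⇒m≤1+n (m≤n⇒m≤1+n k≤r))
                                                    (⊨-≗ {env = env} (m≤n⇒m≤1+n k≤r) same₁ ρ⊨)
    = _ , _
    , ⇓seq exec₁ (⇓seq exec₂ (⇓seq ⇓const (proj₁ (proj₂ loop))))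
    -- Clearing the accumulator and leaving the loop take two steps, the rounds four each.
    , +-bound (expDegree δ e) _ time₁ (+-bound (expDegree δ f) _ time₂
        (+-bound 1 (valueDegree δ f + 2) 2≤N^1 (*-bound (valueDegree δ f) 2 (value-bound {env = env} env≤ f) 4≤N^2)))
    , ≗-trans (proj₁ (proj₂ (proj₂ loop)))
        (≗-trans (≗-≔ ρ₂ ≤-refl) (≗-trans (≗-weaken (m≤n+m r 2) same₂) (≗-weaken (n≤1+n r) same₁)))
    , (begin
        proj₁ loop r                          ≡⟨ proj₂ (proj₂ (proj₂ loop)) ⟩
        eval μ f env * ρ₃ (1 + r) + ρ₃ r      ≡⟨ cong₂ (λ x y → eval μ f env * x + y) (ρ₃-other (<⇒≢ ≤-refl)) (≔-same ρ₂ r 0) ⟩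
        eval μ f env * ρ₂ (1 + r) + 0         ≡⟨ +-identityʳ _ ⟩
        eval μ f env * ρ₂ (1 + r)             ≡⟨ cong (eval μ f env *_) (trans (same₂ ≤-refl) val₁) ⟩
        eval μ f env * eval μ e env           ∎)
    where
    open ≡-Reasoning
    ρ₃ : Reg → ℕ
    ρ₃ = ρ₂ [ r ≔ 0 ]
    ρ₃-other : ∀ {s} → r ≢ s → ρ₃ s ≡ ρ₂ s
    ρ₃-other = ≔-other ρ₂ 0
    loop = multiply r (eval μ f env) ρ₃ (trans (ρ₃-other (<⇒≢ (m≤n+m (suc r) 1))) val₂)
  compileExp-correct {δ = δ} {env} env≤ (mem e) {r} k≤r {ρ} ρ⊨
    with t₁ , ρ₁ , exec₁ , time₁ , same₁ , val₁ ← compileExp-correct {env = env} env≤ e k≤r ρ⊨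
    = _ , _ , ⇓seq exec₁ ⇓load , +-bound (expDegree δ e) 0 time₁ ≤-refl
    , ≗-trans (≗-≔ ρ₁ ≤-refl) same₁ , trans (≔-same ρ₁ r _) (cong μ val₁)

  Executes : ∀ {k} → Program → Word → ℕ → (Reg → ℕ) → Vec ℕ k → Set
  Executes {k} P w T ρ env = ∀ {o} → ∃ λ t → ∃ λ ρ′ →
    ⟨ P , state ρ μ o ⟩⇓[ t ] state ρ′ μ (o ++ w) × t ≤ T × ρ′ ≗[ k ] ρ

  output-≡ : ∀ {P σ t ρ w w′} → w ≡ w′ → ⟨ P , σ ⟩⇓[ t ] state ρ μ w → ⟨ P , σ ⟩⇓[ t ] state ρ μ w′
  output-≡ refl exec = exec

  -- The body works in the context extended by the index, so its frame condition covers register `k`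
  -- and the counter survives each round.
  loop-correct : ∀ {k T P} {env : Vec ℕ k} (g : ℕ → Word) n →
    (∀ {j ρ} → j < n → ρ ⊨ (j ∷ env) → Executes P (g j) T ρ (j ∷ env)) →
    ∀ {ρ} → ρ k ≡ n → ρ ⊨ env →
    Executes (whilePos k repeat (const (1 + k) 1 ⨾ sub k k (1 + k) ⨾ P))
             (concatMap g (downFrom n)) (1 + n * (3 + T)) ρ env
  loop-correct {k} {P = P} g zero body {ρ} eq ρ⊨ {o} =
    1 , ρ , output-≡ (sym (++-identityʳ o)) (⇓exit eq) , ≤-refl , λ _ → refl
  loop-correct {k} {T} {P} {env} g (suc n) body {ρ} eq ρ⊨ {o} =
    let t₁ , ρ₃ , exec₁ , time₁ , same₁ = body ≤-refl ρ₂⊨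
        t₂ , ρ₄ , exec₂ , time₂ , same₂ =
          loop-correct g n (λ j<n → body (m≤n⇒m≤1+n j<n)) (trans (same₁ ≤-refl) ρ₂-count)
            (⊨-≗ {env = env} (n≤1+n k) same₁ (λ i → ρ₂⊨ (suc i)))
    in
      _ , ρ₄
    , output-≡ (++-assoc o _ _)
        (⇓loop (λ z → 0≢1+n (trans (sym z) eq)) (⇓seq ⇓const (⇓seq ⇓sub exec₁)) exec₂)
    , s≤s (begin
        2 + t₁ + t₂                         ≤⟨ +-mono-≤ (+-monoʳ-≤ 2 time₁) time₂ ⟩
        2 + T + (1 + n * (3 + T))           ≡⟨ +-suc (2 + T) _ ⟩
        suc n * (3 + T)                     ∎)
    , ≗-trans same₂ (≗-trans (≗-weaken (n≤1+n k) same₁) ρ₂≗ρ)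
    where
    open ≤-Reasoning
    ρ₁ ρ₂ : Reg → ℕ
    ρ₁ = ρ [ 1 + k ≔ 1 ]
    ρ₂ = ρ₁ [ k ≔ ρ₁ k ∸ ρ₁ (1 + k) ]
    ρ₂≗ρ : ρ₂ ≗[ k ] ρ
    ρ₂≗ρ = ≗-trans (≗-≔ ρ₁ ≤-refl) (≗-≔ ρ (n≤1+n k))
    ρ₂-count : ρ₂ k ≡ n
    ρ₂-count = trans (≔-same ρ₁ k _)
      (cong₂ _∸_ (trans (≗-≔ ρ ≤-refl ≤-refl) eq) (≔-same ρ (1 + k) 1))
    ρ₂⊨ : ρ₂ ⊨ (n ∷ env)
    ρ₂⊨ zero    = ρ₂-count
    ρ₂⊨ (suc i) = ⊨-≗ {env = env} ≤-refl ρ₂≗ρ ρ⊨ i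

  compile-correct : ∀ {k δ} (P : Code Bits k) {env : Vec ℕ k} → Bounded δ env →
    ∀ {ρ} → ρ ⊨ env → Executes (compile P) (word μ P env) (N ^ codeDegree δ P) ρ env
  compile-correct stop env≤ {ρ} ρ⊨ {o} =
    1 , ρ , output-≡ (sym (++-identityʳ o)) ⇓skip , ≤-refl , λ _ → refl
  compile-correct (emit b) env≤ {ρ} ρ⊨ = 1 , ρ , ⇓print , ≤-refl , λ _ → refl
  compile-correct {δ = δ} (P ▸ Q) {env} env≤ {ρ} ρ⊨ {o}
    with t₁ , ρ₁ , exec₁ , time₁ , same₁ ← compile-correct P env≤ ρ⊨ {o}
    with t₂ , ρ₂ , exec₂ , time₂ , same₂ ← compile-correct Q env≤ (⊨-≗ {env = env} ≤-refl same₁ ρ⊨) {o ++ word μ P env}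
    = _ , ρ₂
    , output-≡ (++-assoc o _ _) (⇓seq exec₁ exec₂)
    , +-bound (codeDegree δ P) (codeDegree δ Q) time₁ time₂
    , ≗-trans same₂ same₁
  compile-correct {k} {δ} (ifEq e f P Q) {env} env≤ {ρ} ρ⊨ {o}
    with t₁ , ρ₁ , exec₁ , time₁ , same₁ , val₁ ← compileExp-correct env≤ e ≤-refl ρ⊨
    with t₂ , ρ₂ , exec₂ , time₂ , same₂ , val₂ ←
      compileExp-correct env≤ f (n≤1+n k) (⊨-≗ {env = env} ≤-refl same₁ ρ⊨)
    = branch (eval μ e env ≡ᵇ eval μ f env) refl
    where
    m n : ℕ
    m = eval μ e env
    n = eval μ f env
    ρ₃ ρ₄ ρ₅ : Reg → ℕ
    ρ₃ = ρ₂ [ 2 + k ≔ ρ₂ k ∸ ρ₂ (1 + k) ]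
    ρ₄ = ρ₃ [ k ≔ ρ₃ (1 + k) ∸ ρ₃ k ]
    ρ₅ = ρ₄ [ k ≔ ρ₄ k + ρ₄ (2 + k) ]
    ρ₂k : ρ₂ k ≡ m
    ρ₂k = trans (same₂ ≤-refl) val₁
    ρ₃≗ρ₂ : ρ₃ ≗[ 2 + k ] ρ₂
    ρ₃≗ρ₂ = ≗-≔ ρ₂ ≤-refl
    ρ₅≗ρ : ρ₅ ≗[ k ] ρ
    ρ₅≗ρ = ≗-trans (≗-≔ ρ₄ ≤-refl) (≗-trans (≗-≔ ρ₃ ≤-refl)
      (≗-trans (≗-weaken (m≤n+m k 2) ρ₃≗ρ₂) (≗-trans (≗-weaken (n≤1+n k) same₂) same₁)))
    ρ₅k : ρ₅ k ≡ (n ∸ m) + (m ∸ n)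
    ρ₅k = trans (≔-same ρ₄ k _) (cong₂ _+_
      (trans (≔-same ρ₃ k _) (cong₂ _∸_ (trans (ρ₃≗ρ₂ ≤-refl) val₂) (trans (ρ₃≗ρ₂ (m≤n+m (suc k) 1)) ρ₂k)))
      (trans (≔-other ρ₃ _ (<⇒≢ (m≤n+m (suc k) 1))) (trans (≔-same ρ₂ (2 + k) _) (cong₂ _∸_ ρ₂k val₂))))
    -- The 4 counts two subtractions, an addition and the test.
    time : ∀ {t t′ d} → t ≤ N ^ t′ → t′ ≤ d → t₁ + (t₂ + (4 + t)) ≤ N ^ (expDegree δ e ⊹ expDegree δ f ⊹ 2 ⊹ d)
    time {d = d} p q = +-bound (expDegree δ e) _ time₁ (+-bound (expDegree δ f) _ time₂
      (+-bound 2 d 4≤N^2 (≤-trans p (N^-mono q))))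
    branch : ∀ b → (m ≡ᵇ n) ≡ b → ∃ λ t → ∃ λ ρ′ →
      ⟨ compile (ifEq e f P Q) , state ρ μ o ⟩⇓[ t ]
        state ρ′ μ (o ++ (if m ≡ᵇ n then word μ P env else word μ Q env)) ×
      t ≤ N ^ codeDegree δ (ifEq e f P Q) × ρ′ ≗[ k ] ρ
    branch true eq rewrite eq
      with t₃ , ρ₆ , exec₃ , time₃ , same₃ ← compile-correct P env≤ (⊨-≗ {env = env} ≤-refl ρ₅≗ρ ρ⊨) {o}
      = _ , _
      , ⇓seq exec₁ (⇓seq exec₂ (⇓seq ⇓sub (⇓seq ⇓sub (⇓seq ⇓add (⇓else
          (trans ρ₅k (trans (cong₂ (λ x y → (x ∸ m) + (m ∸ y)) (sym m≡n) (sym m≡n)) (cong₂ _+_ (n∸n≡0 m) (n∸n≡0 m)))) exec₃)))))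
      , time {t′ = codeDegree δ P} {codeDegree δ P ⊹ codeDegree δ Q} time₃ (m≤n⇒m≤1+n (m≤m+n _ _))
      , ≗-trans same₃ ρ₅≗ρ
      where
      m≡n : m ≡ n
      m≡n = ≡ᵇ⇒≡ m n (subst T (sym eq) _)
    branch false eq rewrite eq
      with t₃ , ρ₆ , exec₃ , time₃ , same₃ ← compile-correct Q env≤ (⊨-≗ {env = env} ≤-refl ρ₅≗ρ ρ⊨) {o}
      = _ , _
      , ⇓seq exec₁ (⇓seq exec₂ (⇓seq ⇓sub (⇓seq ⇓sub (⇓seq ⇓add (⇓then
          (λ z → m≢n (∣m∸n∣≡0 (trans (sym ρ₅k) z))) exec₃)))))
      , time {t′ = codeDegree δ Q} {codeDegree δ P ⊹ codeDegree δ Q} time₃ (m≤n⇒m≤1+n (m≤n+m _ _))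
      , ≗-trans same₃ ρ₅≗ρ
      where
      m≢n : m ≢ n
      m≢n m≡n = subst T eq (≡⇒≡ᵇ m n m≡n)
      ∣m∸n∣≡0 : (n ∸ m) + (m ∸ n) ≡ 0 → m ≡ n
      ∣m∸n∣≡0 z = ≤-antisym (m∸n≡0⇒m≤n (m+n≡0⇒n≡0 (n ∸ m) z)) (m∸n≡0⇒m≤n (m+n≡0⇒m≡0 (n ∸ m) z))
  compile-correct {k} {δ} (for e P) {env} env≤ {ρ} ρ⊨ {o}
    with t₁ , ρ₁ , exec₁ , time₁ , same₁ , val₁ ← compileExp-correct env≤ e ≤-refl ρ⊨
    with t₂ , ρ₂ , exec₂ , time₂ , same₂ ←
      loop-correct {env = env} (λ j → word μ P (j ∷ env)) (eval μ e env)
        (λ {j} j<n → compile-correct {δ = δ + valueDegree δ e} P {j ∷ env} (λ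
          { zero    → ≤-trans (<⇒≤ j<n) (≤-trans (value-bound env≤ e) (N^-mono (m≤n+m (valueDegree δ e) δ)))
          ; (suc i) → ≤-trans (env≤ i) (N^-mono (m≤m+n δ _)) }))
        val₁ (⊨-≗ {env = env} ≤-refl same₁ ρ⊨) {o}
    = _ , _ , ⇓seq exec₁ exec₂
    , +-bound (expDegree δ e) _ time₁ (≤-trans time₂ (+-bound 0 (valueDegree δ e + (2 ⊹ codeDegree (δ + valueDegree δ e) P)) ≤-refl
        (*-bound (valueDegree δ e) (2 ⊹ codeDegree (δ + valueDegree δ e) P) (value-bound env≤ e)
          (+-bound 2 (codeDegree (δ + valueDegree δ e) P) (≤-trans (n≤1+n 3) 4≤N^2) ≤-refl))))
    , ≗-trans same₂ same₁

-- Programs printing linear systems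

contents≤1 : ∀ w i → contents w i ≤ 1
contents≤1 []          i       = z≤n
contents≤1 (true  ∷ w) zero    = ≤-refl
contents≤1 (false ∷ w) zero    = z≤n
contents≤1 (true  ∷ w) (suc i) = contents≤1 w i
contents≤1 (false ∷ w) (suc i) = contents≤1 w i

^-distribʳ-* : ∀ d m n → (m * n) ^ d ≡ m ^ d * n ^ d
^-distribʳ-* zero    m n = refl
^-distribʳ-* (suc d) m n = trans (cong (m * n *_) (^-distribʳ-* d m n)) (interchange m n (m ^ d) (n ^ d))
  where open import Algebra.Properties.CommutativeSemigroup *-commutativeSemigroup

-- The base 2 + L is at least 2 even for the empty input and bounds the only initial variable, the
-- input length L. It is at most 2 * (1 + L), which yields the constant 2 ^ d.
word-polynomialTime : {A B : Set} (encA : A → Word) (encB : B → Word) (f : A → B) (P : Code Bits 1) →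
  (∀ x → word (contents (encA x)) P (length (encA x) ∷ []) ≡ encB (f x)) →
  PolynomialTime encA encB f
word-polynomialTime encA encB f P correct = compile P , 2 ^ d , d , λ x →
  let L = length (encA x)
      open Compilation {2 + L} (s≤s (s≤s z≤n)) (contents≤1 (encA x))
      t , ρ , exec , time , _ =
        compile-correct {δ = 1} P {L ∷ []}
          (λ { zero → ≤-trans (m≤n+m L 2) (≤-reflexive (sym (*-identityʳ (2 + L)))) })
          {(λ _ → 0) [ 0 ≔ L ]} (λ { zero → refl })
  in t , _ , exec , correct x , (begin
    t                   ≤⟨ time ⟩
    (2 + L) ^ d         ≤⟨ ^-monoˡ-≤ d (≤-trans (+-monoʳ-≤ 2 (m≤n*m L 2)) (≤-reflexive (sym (*-suc 2 L)))) ⟩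
    (2 * suc L) ^ d     ≡⟨ ^-distribʳ-* d 2 (suc L) ⟩
    2 ^ d * suc L ^ d   ∎)
  where
  d = codeDegree 1 P
  open ≤-Reasoning

-- Linear equations over ℤ₂ given by lists of indices

sumℙ : List Parity → Parity
sumℙ = foldr _+ℙ_ 0ℙ

δ : ℕ → ℕ → Parity
δ p k = if p ≡ᵇ k then 1ℙ else 0ℙ

-- Vectors are indexed downwards because loops count down: f 0 comes last.
tabulate↓ : {A : Set} (m : ℕ) → (ℕ → A) → Vec A m
tabulate↓ zero    f = []
tabulate↓ (suc m) f = f m ∷ tabulate↓ m f

-- A coordinate taken as the product with a unit vector: it is linear by construction, and 0 for an
-- index out of range.
at : ∀ {m} → Vec Parity m → ℕ → Parity
at {m} x k = tabulate↓ m (λ p → δ p k) · x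

-- The coefficients form a sum of unit vectors, so an index that is listed twice cancels.
equation : ∀ m → List ℕ → Parity → Equation m
equation m ks b = tabulate↓ m (λ p → sumℙ (map (δ p) ks)) ≐ b

zero-· : ∀ {m} (x : Vec Parity m) → tabulate↓ m (λ _ → 0ℙ) · x ≡ 0ℙ
zero-· []      = refl
zero-· (b ∷ x) = zero-· x

+-interchange : ∀ p q r s → (p +ℙ q) +ℙ (r +ℙ s) ≡ (p +ℙ r) +ℙ (q +ℙ s)
+-interchange = interchange
  where open import Algebra.Properties.CommutativeSemigroup ℙ.+-commutativeSemigroup

+-· : ∀ {m} f g (x : Vec Parity m) →
      tabulate↓ m (λ p → f p +ℙ g p) · x ≡ tabulate↓ m f · x +ℙ tabulate↓ m g · x
+-· f g []              = refl
+-· {suc m} f g (b ∷ x) = trans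
  (cong₂ _+ℙ_ (ℙ.*-distribʳ-+ b (f m) (g m)) (+-· f g x)) (+-interchange (f m *ℙ b) (g m *ℙ b) _ _)

equation-· : ∀ {m} (x : Vec Parity m) ks →
             tabulate↓ m (λ p → sumℙ (map (δ p) ks)) · x ≡ sumℙ (map (at x) ks)
equation-· x []       = zero-· x
equation-· x (k ∷ ks) = trans (+-· (λ p → δ p k) _ x) (cong (at x k +ℙ_) (equation-· x ks))

δ-refl : ∀ k → δ k k ≡ 1ℙ
δ-refl k rewrite ≡ᵇ-refl k = refl

δ-≢ : ∀ {p k} → p ≢ k → δ p k ≡ 0ℙ
δ-≢ p≢k rewrite ≢⇒≡ᵇ p≢k = refl

at-≥ : ∀ {m k} (x : Vec Parity m) → m ≤ k → at x k ≡ 0ℙ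
at-≥ []      m≤k = refl
at-≥ {suc m} (b ∷ x) m<k rewrite δ-≢ (<⇒≢ m<k) = at-≥ x (<⇒≤ m<k)

at-tabulate↓ : ∀ f {m k} → k < m → at (tabulate↓ m f) k ≡ f k
at-tabulate↓ f {suc m} {k} (s≤s k≤m) with m ≟ k
... | yes refl rewrite δ-refl m = trans (cong (f m +ℙ_) (at-≥ (tabulate↓ m f) ≤-refl)) (ℙ.+-identityʳ (f m))
... | no m≢k rewrite δ-≢ m≢k = at-tabulate↓ f (≤∧≢⇒< k≤m (≢-sym m≢k))

-- Printing the rows of an augmented matrix

weaken : ∀ {k} → Exp k → Exp (suc k)
weaken (var i) = var (suc i)
weaken (lit c) = lit c
weaken (e ⊕ f) = weaken e ⊕ weaken f
weaken (e ⊗ f) = weaken e ⊗ weaken f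
weaken (mem e) = mem (weaken e)

Row : ℕ → Set
Row k = List (Exp k) × Parity

-- Variable `zero` is the current column and `b` the parity of the matches met so far; it is kept in
-- the code, as the language has no assignment.
coefficient : ∀ {k} → List (Exp (suc k)) → Parity → Code Bits (suc k)
coefficient []       b = emit (encodeParity b)
coefficient (e ∷ es) b = ifEq (var zero) e (coefficient es (b ⁻¹)) (coefficient es b)

rowBits : ∀ {k} → Exp k → Row k → Code Bits k
rowBits m (es , b) = for m (coefficient (map weaken es) 0ℙ) ▸ emit (encodeParity b)

toBits : ∀ {k} → Exp k → Code Row k → Code Bits k
toBits m stop           = stop
toBits m (emit r)       = rowBits m r
toBits m (P ▸ Q)        = toBits m P ▸ toBits m Q
toBits m (ifEq e f P Q) = ifEq e f (toBits m P) (toBits m Q)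
toBits m (for e P)      = for e (toBits (weaken m) P)

concatMap-concatMap : {A B C : Set} (f : B → List C) (g : A → List B) (xs : List A) →
  concatMap f (concatMap g xs) ≡ concatMap (concatMap f ∘ g) xs
concatMap-concatMap f g []       = refl
concatMap-concatMap f g (x ∷ xs) =
  trans (concatMap-++ f (g x) _) (cong (concatMap f (g x) ++_) (concatMap-concatMap f g xs))

module _ (μ : ℕ → ℕ) where

  eval-weaken : ∀ {k} (e : Exp k) j env → eval μ (weaken e) (j ∷ env) ≡ eval μ e env
  eval-weaken (var i) j env = refl
  eval-weaken (lit c) j env = refl
  eval-weaken (e ⊕ f) j env = cong₂ _+_ (eval-weaken e j env) (eval-weaken f j env)
  eval-weaken (e ⊗ f) j env = cong₂ _*_ (eval-weaken f j env) (eval-weaken e j env)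
  eval-weaken (mem e) j env = cong μ (eval-weaken e j env)

  rowEquation : ∀ m {k} → Row k → Vec ℕ k → Equation m
  rowEquation m (es , b) env = equation m (map (λ e → eval μ e env) es) b

  word-coefficient : ∀ {k} es b p (env : Vec ℕ k) → word μ (coefficient es b) (p ∷ env) ≡
    [ encodeParity (b +ℙ sumℙ (map (λ e → δ p (eval μ e (p ∷ env))) es)) ]
  word-coefficient []       b p env = cong ([_] ∘ encodeParity) (sym (ℙ.+-identityʳ b))
  word-coefficient (e ∷ es) b p env with p ≡ᵇ eval μ e (p ∷ env)
  ... | false = word-coefficient es b p env
  ... | true  = trans (word-coefficient es (b ⁻¹) p env) (cong ([_] ∘ encodeParity) (flip b _))
    where
    flip : ∀ b s → b ⁻¹ +ℙ s ≡ b +ℙ s ⁻¹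
    flip 0ℙ s = refl
    flip 1ℙ s = sym (ℙ.⁻¹-involutive s)

  encode-tabulate↓ : ∀ m f b → concatMap (λ p → [ encodeParity (f p) ]) (downFrom m) ∷ʳ encodeParity b ≡
                               encodeEquation (tabulate↓ m f ≐ b)
  encode-tabulate↓ zero    f b = refl
  encode-tabulate↓ (suc m) f b = cong (encodeParity (f m) ∷_) (encode-tabulate↓ m f b)

  word-rowBits : ∀ {k} m r (env : Vec ℕ k) →
    word μ (rowBits m r) env ≡ encodeEquation (rowEquation (eval μ m env) r env)
  word-rowBits m (es , b) env = trans
    (cong (_∷ʳ encodeParity b) (concatMap-cong
      (λ p → trans (word-coefficient (map weaken es) 0ℙ p env) (cong ([_] ∘ encodeParity ∘ sumℙ) (begin
        map (λ e → δ p (eval μ e (p ∷ env))) (map weaken es) ≡⟨ sym (map-∘ es) ⟩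
        map (λ e → δ p (eval μ (weaken e) (p ∷ env))) es     ≡⟨ map-cong (λ e → cong (δ p) (eval-weaken e p env)) es ⟩
        map (λ e → δ p (eval μ e env)) es                    ≡⟨ map-∘ es ⟩
        map (δ p) (map (λ e → eval μ e env) es)              ∎)))
      (downFrom (eval μ m env))))
    (encode-tabulate↓ (eval μ m env) _ b)
    where open ≡-Reasoning

  -- The expression `m` for the number of columns is weakened under every loop while its value
  -- stays; the separate `M` keeps the type of the equations fixed.
  word-toBits : ∀ {k} m {M} (P : Code Row k) {env} → eval μ m env ≡ M →
    word μ (toBits m P) env ≡ concatMap encodeEquation (run μ (rowEquation M) P env)
  word-toBits m stop     eq = refl
  word-toBits m (emit r) refl = trans (word-rowBits m r _) (sym (++-identityʳ _))
  word-toBits m (P ▸ Q)  {env} eq = trans (cong₂ _++_ (word-toBits m P eq) (word-toBits m Q eq))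
    (sym (concatMap-++ encodeEquation (run μ (rowEquation _) P env) _))
  word-toBits m (ifEq e f P Q) {env} eq with eval μ e env ≡ᵇ eval μ f env
  ... | true  = word-toBits m P eq
  ... | false = word-toBits m Q eq
  word-toBits m (for e P) {env} eq = trans
    (concatMap-cong (λ j → word-toBits (weaken m) P (trans (eval-weaken m j env) eq)) (downFrom (eval μ e env)))
    (sym (concatMap-concatMap encodeEquation (λ j → run μ (rowEquation _) P (j ∷ env)) (downFrom (eval μ e env))))

-- The input has length 1 + n + n * n, which determines n.
systemBits : Code Row 2 → Code Bits 1
systemBits P = for (var 0F) (ifEq (lit 1 ⊕ n ⊕ n ⊗ n) (var 1F)
    (for (n ⊗ n) (emit true) ▸ emit false ▸ toBits (n ⊗ n) P)
    stop)
  where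
  n : Exp 2
  n = var 0F

systemOf : Code Row 2 → (ℕ → ℕ) → ℕ → LinearSystem
systemOf P μ n = record
  { variables = n * n
  ; equations = run μ (rowEquation μ (n * n)) P (n ∷ 1 + n + n * n ∷ [])
  }

concatMap-downFrom-empty : {A : Set} (g : ℕ → List A) → ∀ m → (∀ {j} → j < m → g j ≡ []) →
  concatMap g (downFrom m) ≡ []
concatMap-downFrom-empty g zero    empty = refl
concatMap-downFrom-empty g (suc m) empty rewrite empty {m} ≤-refl =
  concatMap-downFrom-empty g m (empty ∘ m≤n⇒m≤1+n)

concatMap-downFrom-single : {A : Set} (g : ℕ → List A) → ∀ {n m} → n < m → (∀ {j} → j ≢ n → g j ≡ []) →
  concatMap g (downFrom m) ≡ g n
concatMap-downFrom-single g {n} {suc m} (s≤s n≤m) empty with m ≟ n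
... | yes refl = trans (cong (g m ++_) (concatMap-downFrom-empty g m (empty ∘ <⇒≢))) (++-identityʳ (g m))
... | no m≢n rewrite empty m≢n = concatMap-downFrom-single g (≤∧≢⇒< n≤m (≢-sym m≢n)) empty

size-mono : ∀ {m n} → m < n → 1 + m + m * m < 1 + n + n * n
size-mono m<n = s<s (+-mono-<-≤ m<n (*-mono-≤ (<⇒≤ m<n) (<⇒≤ m<n)))

size-injective : ∀ {m n} → 1 + m + m * m ≡ 1 + n + n * n → m ≡ n
size-injective {m} {n} eq with m <? n | n <? m
... | yes m<n | _       = ⊥-elim (<⇒≢ (size-mono m<n) eq)
... | no _    | yes n<m = ⊥-elim (<⇒≢ (size-mono n<m) (sym eq))
... | no m≮n  | no n≮m  = ≤-antisym (≮⇒≥ n≮m) (≮⇒≥ m≮n)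

concatMap-replicate : ∀ m → concatMap (λ _ → [ true ]) (downFrom m) ≡ replicate m true
concatMap-replicate zero    = refl
concatMap-replicate (suc m) = cong (true ∷_) (concatMap-replicate m)

word-systemBits : ∀ P μ n → word μ (systemBits P) (1 + n + n * n ∷ []) ≡ encodeSystem (systemOf P μ n)
word-systemBits P μ n = trans
  -- The search over all numbers below the input length reaches n, because n < 1 + n + n * n.
  (concatMap-downFrom-single g (s≤s (m≤m+n n (n * n))) g-other)
  (trans g-n (cong₂ (λ v w → v ++ false ∷ w) (concatMap-replicate (n * n)) (word-toBits μ _ P refl)))
  where
  L = 1 + n + n * n
  body : Code Bits 2
  body = for (var 0F ⊗ var 0F) (emit true) ▸ emit false ▸ toBits (var 0F ⊗ var 0F) P
  g : ℕ → Word
  g j = if 1 + j + j * j ≡ᵇ L then word μ body (j ∷ L ∷ []) else []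
  g-other : ∀ {j} → j ≢ n → g j ≡ []
  g-other j≢n rewrite ≢⇒≡ᵇ (j≢n ∘ size-injective) = refl
  g-n : g n ≡ word μ body (n ∷ L ∷ [])
  g-n rewrite ≡ᵇ-refl L = refl

-- One block of equations for every triple of vertices

-- A constraint Σ xᵢ = b on the colours x₀, x₁, x₂ of the edges uv, vw, uw of a triple.
Constraint : Set
Constraint = List (Fin 3) × Parity

Holds : (Fin 3 → Parity) → Constraint → Set
Holds y (is , b) = sumℙ (map y is) ≡ b

triple : {A : Set} → A → A → A → Fin 3 → A
triple a b c 0F = a
triple a b c 1F = b
triple a b c 2F = c

-- The bit read at run time selects between two pieces of code built beforehand, which lets a table
-- over `Bool` be compiled into branches.
testBit : ∀ {X k} → Exp k → (Bool → Code X k) → Code X k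
testBit e P = ifEq (mem e) (lit 0) (P false) (P true)

emitAll : ∀ {k} → (Fin 3 → Exp k) → List Constraint → Code Row k
emitAll e = foldr (λ { (is , b) P → emit (map e is , b) ▸ P }) stop

module Generator (constraints : Bool → Bool → Bool → List Constraint) where

  n u v w : Exp 5
  n = var 3F
  u = var 2F
  v = var 1F
  w = var 0F

  edge : Exp 5 → Exp 5 → Exp 5
  edge i j = i ⊗ n ⊕ j

  -- The matrix starts after the header 1ⁿ0 of length 1 + n.
  cell : Exp 5 → Exp 5
  cell e = lit 1 ⊕ n ⊕ e

  edges : Fin 3 → Exp 5
  edges = triple (edge u v) (edge v w) (edge u w)

  rows₂ : Bool → Bool → Code Row 5
  rows₂ a b = testBit (cell (edge u w)) λ c → emitAll edges (constraints a b c)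

  rows₁ : Bool → Code Row 5
  rows₁ a = testBit (cell (edge v w)) (rows₂ a)

  tripleRows : Code Row 5
  tripleRows = testBit (cell (edge u v)) rows₁

  body : Code Row 5
  -- Symmetry is stated outside the distinctness tests, hence for every ordered pair; for u = v the
  -- two indices cancel and the equation is 0 = 0.
  body = emit (edge u v ∷ edge v u ∷ [] , 0ℙ) ▸
         ifEq u v stop (ifEq v w stop (ifEq u w stop tripleRows))

  generator : Code Row 2
  generator = for (var 0F) (for (var 1F) (for (var 2F) body))

-- Solutions of the generated system as conditions on triples

All-concatMap-downFrom : ∀ {n} {A : Set} {P : A → Set} (g : ℕ → List A) →
  All P (concatMap g (downFrom n)) ⇔ (∀ (i : Fin n) → All P (g (toℕ i)))
All-concatMap-downFrom {P = P} g = mk⇔ (λ p i → to< p (toℕ<n i)) (λ h → from< λ i<n → subst (All P ∘ g) (toℕ-fromℕ< i<n) (h (fromℕ< i<n)))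
  where
  to< : ∀ {n} → All P (concatMap g (downFrom n)) → ∀ {i} → i < n → All P (g i)
  to< {suc n} p {i} (s≤s i≤n) with i ≟ n
  ... | yes refl = ++⁻ˡ (g i) p
  ... | no i≢n   = to< (++⁻ʳ (g n) p) (≤∧≢⇒< i≤n i≢n)
  from< : ∀ {n} → (∀ {i} → i < n → All P (g i)) → All P (concatMap g (downFrom n))
  from< {zero}  h = []
  from< {suc n} h = ++⁺ (h ≤-refl) (from< (h ∘ m≤n⇒m≤1+n))

Holds-cong : ∀ {y z} → (∀ i → y i ≡ z i) → ∀ c → Holds y c → Holds z c
Holds-cong eq (is , b) = trans (cong sumℙ (sym (map-cong eq is)))

bit : Bool → ℕ
bit b = if b then 1 else 0

run-testBit : ∀ {X : ℕ → Set} {A : Set} {k} μ (g : ∀ {k} → X k → Vec ℕ k → A) (e : Exp k) (P : Bool → Code X k) {env} b →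
  μ (eval μ e env) ≡ bit b → run μ g (testBit e P) env ≡ run μ g (P b) env
run-testBit μ g e P false eq rewrite eq = refl
run-testBit μ g e P true  eq rewrite eq = refl

module TripleSystem {n : ℕ} (G : Graph n) (μ : ℕ → ℕ)
    (μ-adj : ∀ u v → μ (1 + n + (n * toℕ u + toℕ v)) ≡ bit (adj G u v))
    (constraints : Bool → Bool → Bool → List Constraint) where

  open Generator constraints using (generator; body; tripleRows)

  module _ (x : Vec Parity (n * n)) where

    edgeVar : Fin n → Fin n → Parity
    edgeVar u v = at x (n * toℕ u + toℕ v)

    All-emitAll : ∀ {k} (e : Fin 3 → Exp k) env (cs : List Constraint) →
      All (x Satisfies_) (run μ (rowEquation μ (n * n)) (emitAll e cs) env) ⇔
      All (Holds (λ i → at x (eval μ (e i) env))) cs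
    All-emitAll e env []               = mk⇔ (λ _ → []) (λ _ → [])
    All-emitAll e env ((is , b) ∷ cs) = mk⇔
      (λ { (p ∷ ps) → trans (sym value) p ∷ to (All-emitAll e env cs) ps })
      (λ { (p ∷ ps) → trans value p ∷ from (All-emitAll e env cs) ps })
      where
      open ≡-Reasoning
      ks = map (λ f → eval μ f env) (map e is)
      value : tabulate↓ (n * n) (λ p → sumℙ (map (δ p) ks)) · x ≡ sumℙ (map (λ i → at x (eval μ (e i) env)) is)
      value = begin
        tabulate↓ (n * n) (λ p → sumℙ (map (δ p) ks)) · x        ≡⟨ equation-· x ks ⟩
        sumℙ (map (at x) ks)                                     ≡⟨ cong (sumℙ ∘ map (at x)) (sym (map-∘ is)) ⟩
        sumℙ (map (at x) (map (λ i → eval μ (e i) env) is))      ≡⟨ cong sumℙ (sym (map-∘ is)) ⟩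
        sumℙ (map (λ i → at x (eval μ (e i) env)) is)            ∎

    TripleHolds : Fin n → Fin n → Fin n → Set
    TripleHolds u v w =
      All (Holds (triple (edgeVar u v) (edgeVar v w) (edgeVar u w))) (constraints (adj G u v) (adj G v w) (adj G u w))

    All-tripleRows : ∀ u v w L →
      All (x Satisfies_) (run μ (rowEquation μ (n * n)) tripleRows (toℕ w ∷ toℕ v ∷ toℕ u ∷ n ∷ L ∷ [])) ⇔ TripleHolds u v w
    All-tripleRows u v w L = mk⇔
      (λ p → All.map (λ {c} → Holds-cong values c) (to (All-emitAll edges env cs) (subst (All (x Satisfies_)) rows p)))
      (λ p → subst (All (x Satisfies_)) (sym rows) (from (All-emitAll edges env cs) (All.map (λ {c} → Holds-cong (sym ∘ values) c) p)))
      where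
      module C = Generator constraints
      env : Vec ℕ 5
      env = toℕ w ∷ toℕ v ∷ toℕ u ∷ n ∷ L ∷ []
      a b c : Bool
      a = adj G u v
      b = adj G v w
      c = adj G u w
      cs : List Constraint
      cs = constraints a b c
      edges : Fin 3 → Exp 5
      edges = C.edges
      values : ∀ i → at x (eval μ (edges i) env) ≡ triple (edgeVar u v) (edgeVar v w) (edgeVar u w) i
      values 0F = refl
      values 1F = refl
      values 2F = refl
      g : ∀ {k} → Row k → Vec ℕ k → Equation (n * n)
      g = rowEquation μ (n * n)
      rows : run μ g tripleRows env ≡ run μ g (emitAll edges cs) env
      rows = trans (run-testBit μ g (C.cell (C.edge C.u C.v)) C.rows₁ {env} a (μ-adj u v))
            (trans (run-testBit μ g (C.cell (C.edge C.v C.w)) (C.rows₂ a) {env} b (μ-adj v w))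
                   (run-testBit μ g (C.cell (C.edge C.u C.w)) (λ c → emitAll edges (constraints a b c)) {env} c (μ-adj u w)))

    BodyHolds : Fin n → Fin n → Fin n → Set
    BodyHolds u v w =
      edgeVar u v +ℙ edgeVar v u ≡ 0ℙ × (u ≢ v → v ≢ w → u ≢ w → TripleHolds u v w)

    All-body : ∀ u v w L →
      All (x Satisfies_) (run μ (rowEquation μ (n * n)) body (toℕ w ∷ toℕ v ∷ toℕ u ∷ n ∷ L ∷ [])) ⇔ BodyHolds u v w
    All-body u v w L = mk⇔
      (λ { (p ∷ ps) → trans (sym symmetry) p , λ u≢v v≢w u≢w →
             to (All-tripleRows u v w L) (subst (All (x Satisfies_)) (distinct u≢v v≢w u≢w) ps) })
      (λ { (p , h) → trans symmetry p ∷ all-distinct h })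
      where
      env : Vec ℕ 5
      env = toℕ w ∷ toℕ v ∷ toℕ u ∷ n ∷ L ∷ []
      ks : List ℕ
      ks = (n * toℕ u + toℕ v) ∷ (n * toℕ v + toℕ u) ∷ []
      symmetry : tabulate↓ (n * n) (λ p → sumℙ (map (δ p) ks)) · x ≡ edgeVar u v +ℙ edgeVar v u
      symmetry = trans (equation-· x ks) (cong (edgeVar u v +ℙ_) (ℙ.+-identityʳ _))
      rows : List (Equation (n * n))
      rows = run μ (rowEquation μ (n * n)) tripleRows env
      guarded : List (Equation (n * n))
      guarded = if toℕ u ≡ᵇ toℕ v then [] else if toℕ v ≡ᵇ toℕ w then [] else if toℕ u ≡ᵇ toℕ w then [] else rows
      distinct : u ≢ v → v ≢ w → u ≢ w → guarded ≡ rows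
      distinct u≢v v≢w u≢w
        rewrite ≢⇒≡ᵇ (u≢v ∘ toℕ-injective) | ≢⇒≡ᵇ (v≢w ∘ toℕ-injective) | ≢⇒≡ᵇ (u≢w ∘ toℕ-injective) = refl
      all-distinct : (u ≢ v → v ≢ w → u ≢ w → TripleHolds u v w) → All (x Satisfies_) guarded
      all-distinct h with toℕ u ≡ᵇ toℕ v in uv | toℕ v ≡ᵇ toℕ w in vw | toℕ u ≡ᵇ toℕ w in uw
      ... | true  | _     | _     = []
      ... | false | true  | _     = []
      ... | false | false | true  = []
      ... | false | false | false = from (All-tripleRows u v w L) (h (≢-toℕ uv) (≢-toℕ vw) (≢-toℕ uw))
        where
        ≢-toℕ : ∀ {i j : Fin n} → (toℕ i ≡ᵇ toℕ j) ≡ false → i ≢ j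
        ≢-toℕ {i} eq refl = subst T eq (≡⇒≡ᵇ (toℕ i) (toℕ i) refl)

    All-generator : All (x Satisfies_) (equations (systemOf generator μ n)) ⇔ (∀ u v w → BodyHolds u v w)
    All-generator = mk⇔
      (λ p u v w → to (All-body u v w L) (to loop₃ (to (loop₂ {u}) (to loop₁ p u) v) w))
      (λ h → from loop₁ λ u → from (loop₂ {u}) λ v → from loop₃ λ w → from (All-body u v w L) (h u v w))
      where
      L : ℕ
      L = 1 + n + n * n
      g : ∀ {k} → Row k → Vec ℕ k → Equation (n * n)
      g = rowEquation μ (n * n)
      loop₁ = All-concatMap-downFrom {n} {P = x Satisfies_} λ i → run μ g (for (var 1F) (for (var 2F) body)) (i ∷ n ∷ L ∷ [])
      loop₂ = λ {u : Fin n} → All-concatMap-downFrom {n} {P = x Satisfies_} λ i → run μ g (for (var 2F) body) (i ∷ toℕ u ∷ n ∷ L ∷ [])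
      loop₃ = λ {u v : Fin n} → All-concatMap-downFrom {n} {P = x Satisfies_} λ i → run μ g body (i ∷ toℕ v ∷ toℕ u ∷ n ∷ L ∷ [])

-- The adjacency matrix in the input word

contents-++ : ∀ v {w} i → contents (v ++ w) (length v + i) ≡ contents w i
contents-++ []          i = refl
contents-++ (true  ∷ v) i = contents-++ v i
contents-++ (false ∷ v) i = contents-++ v i

contents-tabulate : ∀ {n} (f : Fin n → Bool) {w} i → contents (tabulate f ++ w) (toℕ i) ≡ bit (f i)
contents-tabulate f zero with f zero
... | true  = refl
... | false = refl
contents-tabulate f (suc i) with f zero
... | true  = contents-tabulate (f ∘ suc) i
... | false = contents-tabulate (f ∘ suc) i

contents-concat : ∀ {m n} (f : Fin m → Fin n → Bool) u v →
  contents (concat (tabulate λ u → tabulate (f u))) (n * toℕ u + toℕ v) ≡ bit (f u v)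
contents-concat {n = n} f zero v rewrite *-zeroʳ n = contents-tabulate (f zero) v
contents-concat {n = n} f (suc u) v = trans
  (cong (contents (row ++ rows)) (begin
    n * suc (toℕ u) + toℕ v             ≡⟨ cong (_+ toℕ v) (*-suc n (toℕ u)) ⟩
    n + n * toℕ u + toℕ v               ≡⟨ +-assoc n _ _ ⟩
    n + (n * toℕ u + toℕ v)             ≡⟨ cong (_+ (n * toℕ u + toℕ v)) (sym (length-tabulate (f zero))) ⟩
    length row + (n * toℕ u + toℕ v)    ∎))
  (trans (contents-++ row _) (contents-concat (f ∘ suc) u v))
  where
  open ≡-Reasoning
  row rows : Word
  row  = tabulate (f zero)
  rows = concat (tabulate λ u → tabulate (f (suc u)))

length-concat-tabulate : ∀ {m n} (f : Fin m → Fin n → Bool) →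
  length (concat (tabulate λ u → tabulate (f u))) ≡ m * n
length-concat-tabulate {zero}  f = refl
length-concat-tabulate {suc m} f = trans (length-++ (tabulate (f zero)))
  (cong₂ _+_ (length-tabulate (f zero)) (length-concat-tabulate (f ∘ suc)))

length-encodeGraph : ∀ {n} (G : Graph n) → length (encodeGraph (n , G)) ≡ 1 + n + n * n
length-encodeGraph {n} G = trans (length-++ (replicate n true))
  (trans (cong₂ (λ x y → x + suc y) (length-replicate n) (length-concat-tabulate (adj G))) (+-suc n (n * n)))

contents-encodeGraph : ∀ {n} (G : Graph n) u v →
  contents (encodeGraph (n , G)) (1 + n + (n * toℕ u + toℕ v)) ≡ bit (adj G u v)
contents-encodeGraph {n} G u v = trans
  (cong (contents (encodeGraph (n , G)))
    (trans (sym (+-suc n _)) (cong (_+ suc (n * toℕ u + toℕ v)) (sym (length-replicate n)))))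
  (trans (contents-++ (replicate n true) _) (contents-concat (adj G) u v))

-- Coloured graphs on three vertices

-- Adjacency and colour merge into one value with decidable equality, so that comparing coloured
-- graphs no longer involves proofs of adjacency.
entryOf : (b : Bool) → (T b → Colour) → Maybe Colour
entryOf true  f = just (f tt)
entryOf false f = nothing

entryOf-cong : ∀ {b b′ f f′} → b ≡ b′ → (∀ p q → f p ≡ f′ q) → entryOf b f ≡ entryOf b′ f′
entryOf-cong {true}  refl eq = cong just (eq tt tt)
entryOf-cong {false} refl eq = refl

is-just-entryOf : ∀ b f → is-just (entryOf b f) ≡ b
is-just-entryOf true  f = refl
is-just-entryOf false f = refl

entryOf-just : ∀ {b} f p → entryOf b f ≡ just (f p)
entryOf-just {true} f p = refl

entry : ∀ {n} → ColouredGraph n → Fin n → Fin n → Maybe Colour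
entry H u v = entryOf (adj (graph H) u v) (colour (colouring H) u v)

entry-sym : ∀ {n} (H : ColouredGraph n) u v → entry H u v ≡ entry H v u
entry-sym H u v = entryOf-cong (adj-sym (graph H) u v) (colour-sym (colouring H) u v)

entry-diag : ∀ {n} (H : ColouredGraph n) u → entry H u u ≡ nothing
entry-diag H u with adj (graph H) u u | colour (colouring H) u u | loopless (graph H) u
... | false | _ | _ = refl

infix 4 _≈_ _≈?_ _≅?_ _∈≅?_

_≈_ : ∀ {m n} → ColouredGraph m → ColouredGraph n → Set
_≈_ {m} {n} H K = Σ (Fin m ↔ Fin n) λ π → ∀ u v → entry H u v ≡ entry K (Inverse.to π u) (Inverse.to π v)

≅⇒≈ : ∀ {m n} {H : ColouredGraph m} {K : ColouredGraph n} → H ≅ K → H ≈ K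
≅⇒≈ iso = bijection , λ u v → entryOf-cong (adj-preserved u v) (colour-preserved u v)
  where open _≅_ iso

≈⇒≅ : ∀ {m n} {H : ColouredGraph m} {K : ColouredGraph n} → H ≈ K → H ≅ K
≈⇒≅ {H = H} {K} (π , eq) = record
  { bijection        = π
  ; adj-preserved    = λ u v → trans (sym (is-just-entryOf _ _)) (trans (cong is-just (eq u v)) (is-just-entryOf _ _))
  ; colour-preserved = λ u v p q → just-injective
      (trans (sym (entryOf-just (colour (colouring H) u v) p)) (trans (eq u v) (entryOf-just (colour (colouring K) _ _) q)))
  }

≈-sym : ∀ {m n} {H : ColouredGraph m} {K : ColouredGraph n} → H ≈ K → K ≈ H
≈-sym {K = K} (π , eq) = ↔-sym π , λ u v → sym (trans (eq _ _) (cong₂ (entry K) (strictlyInverseˡ u) (strictlyInverseˡ v)))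
  where open Inverse π

≈-trans : ∀ {l m n} {H : ColouredGraph l} {K : ColouredGraph m} {L : ColouredGraph n} → H ≈ K → K ≈ L → H ≈ L
≈-trans (π , eq) (ρ , eq′) = (ρ ↔-∘ π) , λ u v → trans (eq u v) (eq′ _ _)

-- Deciding isomorphism

any-Vec? : ∀ {m n} {P : Vec (Fin n) m → Set} → (∀ f → Dec (P f)) → Dec (∃ P)
any-Vec? {zero}  P? = map′ ([] ,_) (λ { ([] , p) → p }) (P? [])
any-Vec? {suc m} P? = map′ (λ { (i , f , p) → i ∷ f , p }) (λ { (i ∷ f , p) → i , f , p })
  (Fin.any? λ i → any-Vec? λ f → P? (i ∷ f))

_≟ᶜ_ : DecidableEquality Colour
red  ≟ᶜ red  = yes refl
red  ≟ᶜ blue = no λ ()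
blue ≟ᶜ red  = no λ ()
blue ≟ᶜ blue = yes refl

-- Exhaustive search for a map and its inverse. Both are vectors of values, since these can be
-- enumerated and determine the map pointwise.
_≈?_ : ∀ {m n} (H : ColouredGraph m) (K : ColouredGraph n) → Dec (H ≈ K)
_≈?_ {m} {n} H K = map′
  (λ { (f , eq , g , fg , gf) → mk↔ₛ′ (lookup f) (lookup g) fg gf , eq })
  (λ { (π , eq) →
    let open Inverse π using () renaming (to to π⁺; from to π⁻; strictlyInverseˡ to invˡ; strictlyInverseʳ to invʳ)
        f = lookup∘tabulate π⁺
        g = lookup∘tabulate π⁻
    in Vec.tabulate π⁺ , (λ u v → trans (eq u v) (sym (cong₂ (entry K) (f u) (f v)))) , Vec.tabulate π⁻
     , (λ i → trans (f _) (trans (cong π⁺ (g i)) (invˡ i)))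
     , (λ i → trans (g _) (trans (cong π⁻ (f i)) (invʳ i))) })
  (any-Vec? {m} {n} λ f →
    (Fin.all? λ u → Fin.all? λ v → ≡-dec _≟ᶜ_ (entry H u v) (entry K (lookup f u) (lookup f v))) ×-dec
    any-Vec? {n} {m} λ g →
      (Fin.all? λ i → lookup f (lookup g i) Fin.≟ i) ×-dec (Fin.all? λ i → lookup g (lookup f i) Fin.≟ i))

_≅?_ : ∀ {m n} (H : ColouredGraph m) (K : ColouredGraph n) → Dec (H ≅ K)
H ≅? K = map′ ≈⇒≅ ≅⇒≈ (H ≈? K)

_∈≅?_ : ∀ {m k} (H : ColouredGraph m) (F : List (ColouredGraph k)) → Dec (H ∈≅ F)
H ∈≅? F = Any.any? (H ≅?_) F

∈≅-resp : ∀ {l m k} {H : ColouredGraph l} {K : ColouredGraph m} {F : List (ColouredGraph k)} →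
          H ≈ K → K ∈≅ F → H ∈≅ F
∈≅-resp {H = H} {K} H≈K = Any.map (λ {L} K≅L → ≈⇒≅ (≈-trans {H = H} {K} {L} H≈K (≅⇒≈ K≅L)))

-- The default `red` on non-edges is the one used by `path`, so that the named paths and triangles
-- are definitionally of this form.
standard : (e₀₁ e₁₂ e₀₂ : Maybe Colour) → ColouredGraph 3
standard a b c =
  graph₃ (is-just a) (is-just b) (is-just c) , colouring₃ _ (fromMaybe red a) (fromMaybe red b) (fromMaybe red c)

entry-standard : ∀ a b c u v → entry (standard a b c) u v ≡ table nothing a b c u v
entry-standard a b c = λ
  { 0F 0F → refl ; 0F 1F → on a ; 0F 2F → on c
  ; 1F 0F → on a ; 1F 1F → refl ; 1F 2F → on b
  ; 2F 0F → on c ; 2F 1F → on b ; 2F 2F → refl }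
  where
  on : ∀ x → entryOf (is-just x) (λ _ → fromMaybe red x) ≡ x
  on (just _) = refl
  on nothing  = refl

entry-table : (H : ColouredGraph 3) → ∀ u v → entry H u v ≡ table nothing (entry H 0F 1F) (entry H 1F 2F) (entry H 0F 2F) u v
entry-table H = λ
  { 0F 0F → entry-diag H 0F   ; 0F 1F → refl              ; 0F 2F → refl
  ; 1F 0F → entry-sym H 1F 0F ; 1F 1F → entry-diag H 1F   ; 1F 2F → refl
  ; 2F 0F → entry-sym H 2F 0F ; 2F 1F → entry-sym H 2F 1F ; 2F 2F → entry-diag H 2F }

≈-standard : (H : ColouredGraph 3) → H ≈ standard (entry H 0F 1F) (entry H 1F 2F) (entry H 0F 2F)
≈-standard H = ↔-id _ , λ u v → trans (entry-table H u v) (sym (entry-standard _ _ _ u v))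

standard-swap : ∀ {a b c a′ b′ c′} i j →
  (∀ u v → table nothing a b c u v ≡ table nothing a′ b′ c′ (transpose i j ⟨$⟩ʳ u) (transpose i j ⟨$⟩ʳ v)) →
  standard a b c ≈ standard a′ b′ c′
standard-swap i j eq = transpose i j , λ u v →
  trans (entry-standard _ _ _ u v) (trans (eq u v) (sym (entry-standard _ _ _ (transpose i j ⟨$⟩ʳ u) (transpose i j ⟨$⟩ʳ v))))

swap₀₁ : ∀ a b c → standard a b c ≈ standard a c b
swap₀₁ a b c = standard-swap 0F 1F λ
  { 0F 0F → refl ; 0F 1F → refl ; 0F 2F → refl ; 1F 0F → refl ; 1F 1F → refl
  ; 1F 2F → refl ; 2F 0F → refl ; 2F 1F → refl ; 2F 2F → refl }

swap₁₂ : ∀ a b c → standard a b c ≈ standard c b a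
swap₁₂ a b c = standard-swap 1F 2F λ
  { 0F 0F → refl ; 0F 1F → refl ; 0F 2F → refl ; 1F 0F → refl ; 1F 1F → refl
  ; 1F 2F → refl ; 2F 0F → refl ; 2F 1F → refl ; 2F 2F → refl }

swap₀₂ : ∀ a b c → standard a b c ≈ standard b a c
swap₀₂ a b c = standard-swap 0F 2F λ
  { 0F 0F → refl ; 0F 1F → refl ; 0F 2F → refl ; 1F 0F → refl ; 1F 1F → refl
  ; 1F 2F → refl ; 2F 0F → refl ; 2F 1F → refl ; 2F 2F → refl }

-- Freeness as a condition on triples of vertices

TripleFree : ∀ {n} → List (ColouredGraph 3) → ColouredGraph n → Set
TripleFree F H = ∀ u v w → u ≢ v → v ≢ w → u ≢ w → ¬ (standard (entry H u v) (entry H v w) (entry H u w) ∈≅ F)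

triple-injective : ∀ {n} {u v w : Fin n} → u ≢ v → v ≢ w → u ≢ w → ∀ {i j} → triple u v w i ≡ triple u v w j → i ≡ j
triple-injective u≢v v≢w u≢w {0F} {0F} _  = refl
triple-injective u≢v v≢w u≢w {0F} {1F} eq = ⊥-elim (u≢v eq)
triple-injective u≢v v≢w u≢w {0F} {2F} eq = ⊥-elim (u≢w eq)
triple-injective u≢v v≢w u≢w {1F} {0F} eq = ⊥-elim (u≢v (sym eq))
triple-injective u≢v v≢w u≢w {1F} {1F} _  = refl
triple-injective u≢v v≢w u≢w {1F} {2F} eq = ⊥-elim (v≢w eq)
triple-injective u≢v v≢w u≢w {2F} {0F} eq = ⊥-elim (u≢w (sym eq))
triple-injective u≢v v≢w u≢w {2F} {1F} eq = ⊥-elim (v≢w (sym eq))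
triple-injective u≢v v≢w u≢w {2F} {2F} _  = refl

Free⇔TripleFree : ∀ {n} F (H : ColouredGraph n) → Free F H ⇔ TripleFree F H
Free⇔TripleFree F H = mk⇔
  (λ free u v w u≢v v≢w u≢w forbidden →
    let ι = mk↣ {to = triple u v w} (triple-injective u≢v v≢w u≢w)
    in free ι (∈≅-resp (≈-standard (induced H ι)) forbidden))
  tripleFree⇒free
  where
  tripleFree⇒free : TripleFree F H → Free F H
  -- An induced subgraph isomorphic to a member of F has exactly three vertices.
  tripleFree⇒free free ι ∈F with refl ← ↔⇒≡ (_≅_.bijection (proj₂ (Any.satisfied ∈F))) =
    free (ι⁺ 0F) (ι⁺ 1F) (ι⁺ 2F) (distinct λ ()) (distinct λ ()) (distinct λ ())
      (∈≅-resp {H = standard _ _ _} {induced H ι}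
        (≈-sym {H = induced H ι} {standard _ _ _} (≈-standard (induced H ι))) ∈F)
    where
    open Injection ι using (injective) renaming (to to ι⁺)
    distinct : ∀ {i j} → i ≢ j → ι⁺ i ≢ ι⁺ j
    distinct i≢j eq = i≢j (injective eq)

-- The equations for F

parity : Colour → Parity
parity red  = 1ℙ
parity blue = 0ℙ

paint : Parity → Colour
paint 1ℙ = red
paint 0ℙ = blue

parity-paint : ∀ p → parity (paint p) ≡ p
parity-paint 0ℙ = refl
parity-paint 1ℙ = refl

evenTriangles oddTriangles : List (ColouredGraph 3)
evenTriangles = bK₃ ∷ rrbK₃ ∷ []
oddTriangles  = rK₃ ∷ rbbK₃ ∷ []

-- The forbidden triangles are those whose number of red edges has parity τ ⁻¹.
forbiddenTriangles : Parity → List (ColouredGraph 3)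
forbiddenTriangles 0ℙ = oddTriangles
forbiddenTriangles 1ℙ = evenTriangles

-- For concrete colours the isomorphism search evaluates, so each case holds by computation;
-- comparing the two decisions replaces sixteen explicit arguments. The trailing 0ℙ is the end of
-- `sumℙ`.
forbiddenTriangle? : ∀ τ c d e →
  does (standard (just c) (just d) (just e) ∈≅? forbiddenTriangles τ) ≡
  does (¬? (parity c +ℙ (parity d +ℙ (parity e +ℙ 0ℙ)) ℙ.≟ τ))
forbiddenTriangle? 0ℙ red  red  red  = refl
forbiddenTriangle? 0ℙ red  red  blue = refl
forbiddenTriangle? 0ℙ red  blue red  = refl
forbiddenTriangle? 0ℙ red  blue blue = refl
forbiddenTriangle? 0ℙ blue red  red  = refl
forbiddenTriangle? 0ℙ blue red  blue = refl
forbiddenTriangle? 0ℙ blue blue red  = refl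
forbiddenTriangle? 0ℙ blue blue blue = refl
forbiddenTriangle? 1ℙ red  red  red  = refl
forbiddenTriangle? 1ℙ red  red  blue = refl
forbiddenTriangle? 1ℙ red  blue red  = refl
forbiddenTriangle? 1ℙ red  blue blue = refl
forbiddenTriangle? 1ℙ blue red  red  = refl
forbiddenTriangle? 1ℙ blue red  blue = refl
forbiddenTriangle? 1ℙ blue blue red  = refl
forbiddenTriangle? 1ℙ blue blue blue = refl

does-transfer : {P Q : Set} (P? : Dec P) (Q? : Dec Q) → does P? ≡ does Q? → P → Q
does-transfer P?      (yes q) eq p = q
does-transfer (no ¬p) (no ¬q) eq p = ⊥-elim (¬p p)

-- The variable of a non-edge may take any value.
Agrees : Maybe Colour → Parity → Set
Agrees nothing  p = ⊤
Agrees (just c) p = p ≡ parity c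

when : {P : Set} → Dec P → Constraint → List Constraint
when (yes _) c = [ c ]
when (no  _) c = []

when⁺ : {P : Set} {y : Fin 3 → Parity} (P? : Dec P) {c : Constraint} → (P → Holds y c) → All (Holds y) (when P? c)
when⁺ (yes p) h = h p ∷ []
when⁺ (no ¬p) h = []

when⁻ : {P : Set} {y : Fin 3 → Parity} (P? : Dec P) {c : Constraint} → All (Holds y) (when P? c) → P → Holds y c
when⁻ (yes _) (h ∷ []) p = h
when⁻ (no ¬p) []       p = ⊥-elim (¬p p)

1≢0 : 1ℙ ≢ 0ℙ
1≢0 ()

-- As a parameter, the decision of membership in F is opaque: only its two outcomes matter below,
-- not the search behind it.
module LocalConstraints
  (F : List (ColouredGraph 3))
  (_∈F? : (H : ColouredGraph 3) → Dec (H ∈≅ F))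
  (paths : (rbP₃ ∈≅ F) ⊎ ((rP₃ ∈≅ F) × (bP₃ ∈≅ F)))
  (τ : Parity)
  (triangles : TrianglesOf F Are forbiddenTriangles τ)
  where

  Forbidden : (a b c : Maybe Colour) → Set
  Forbidden a b c = standard a b c ∈≅ F

  Forbidden? : ∀ a b c → Dec (Forbidden a b c)
  Forbidden? a b c = standard a b c ∈F?

  -- The constraint with no variables and right-hand side 1ℙ reads 0 = 1: one such triple makes the
  -- system unsolvable.
  none : List Constraint
  none = when (Forbidden? nothing nothing nothing) ([] , 1ℙ)

  single : Fin 3 → List Constraint
  single i = when (Forbidden? (just red) nothing nothing) (i ∷ [] , 0ℙ) ++
             when (Forbidden? (just blue) nothing nothing) (i ∷ [] , 1ℙ)

  -- With mixed paths forbidden the two edges share a colour, so forbidding a monochromatic path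
  -- just fixes the colour of edge `i`. With both monochromatic paths forbidden the colours differ,
  -- and forbidding the mixed path as well leaves nothing.
  pairWith : (rbP₃ ∈≅ F) ⊎ ((rP₃ ∈≅ F) × (bP₃ ∈≅ F)) → Fin 3 → Fin 3 → List Constraint
  pairWith (inj₁ _) i j = (i ∷ j ∷ [] , 0ℙ) ∷ when (rP₃ ∈F?) (i ∷ [] , 0ℙ) ++ when (bP₃ ∈F?) (i ∷ [] , 1ℙ)
  pairWith (inj₂ _) i j = (i ∷ j ∷ [] , 1ℙ) ∷ when (rbP₃ ∈F?) ([] , 1ℙ)

  pair : Fin 3 → Fin 3 → List Constraint
  pair = pairWith paths

  -- The Booleans tell which of the edges uv, vw, uw are present.
  constraints : Bool → Bool → Bool → List Constraint
  constraints false false false = none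
  constraints true  false false = single 0F
  constraints false true  false = single 1F
  constraints false false true  = single 2F
  constraints true  true  false = pair 0F 1F
  constraints true  false true  = pair 0F 2F
  constraints false true  true  = pair 2F 1F
  constraints true  true  true  = (0F ∷ 1F ∷ 2F ∷ [] , τ) ∷ []

  module _ (y : Fin 3 → Parity) where

    none-correct : All (Holds y) none ⇔ (¬ Forbidden nothing nothing nothing)
    none-correct = mk⇔ (λ h f → 1≢0 (sym (when⁻ (Forbidden? _ _ _) h f))) (λ ¬f → when⁺ (Forbidden? _ _ _) (λ f → ⊥-elim (¬f f)))

    single-correct : ∀ i c → y i ≡ parity c → All (Holds y) (single i) ⇔ (¬ Forbidden (just c) nothing nothing)
    single-correct i c eq = mk⇔ (λ h → sound c eq (++⁻ˡ (when red? _) h) (++⁻ʳ (when red? _) h)) (λ ¬f → complete c eq ¬f)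
      where
      red? = Forbidden? (just red) nothing nothing
      blue? = Forbidden? (just blue) nothing nothing
      sound : ∀ c → y i ≡ parity c → All (Holds y) (when red? (i ∷ [] , 0ℙ)) → All (Holds y) (when blue? (i ∷ [] , 1ℙ)) →
              ¬ Forbidden (just c) nothing nothing
      sound red  eq h _ f = 1≢0 (trans (sym (cong (_+ℙ 0ℙ) eq)) (when⁻ red? h f))
      sound blue eq _ h f = 1≢0 (trans (sym (when⁻ blue? h f)) (cong (_+ℙ 0ℙ) eq))
      complete : ∀ c → y i ≡ parity c → ¬ Forbidden (just c) nothing nothing → All (Holds y) (single i)
      complete red  eq ¬f = ++⁺ (when⁺ red? (λ f → ⊥-elim (¬f f))) (when⁺ blue? (λ _ → cong (_+ℙ 0ℙ) eq))
      complete blue eq ¬f = ++⁺ (when⁺ red? (λ _ → cong (_+ℙ 0ℙ) eq)) (when⁺ blue? (λ f → ⊥-elim (¬f f)))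

    brP₃∈F : rbP₃ ∈≅ F → Forbidden (just blue) (just red) nothing
    brP₃∈F = ∈≅-resp {K = rbP₃} (swap₀₂ (just blue) (just red) nothing)

    pairWith-correct : ∀ p i j c d → y i ≡ parity c → y j ≡ parity d →
      All (Holds y) (pairWith p i j) ⇔ (¬ Forbidden (just c) (just d) nothing)
    pairWith-correct (inj₁ rb) i j c d yi yj = mk⇔ (λ { (h ∷ hs) → sound c d yi (trans (sym (value yi yj)) h) hs }) (complete c d yi (value yi yj))
      where
      value : ∀ {c d} → y i ≡ parity c → y j ≡ parity d → y i +ℙ (y j +ℙ 0ℙ) ≡ parity c +ℙ (parity d +ℙ 0ℙ)
      value = cong₂ (λ p q → p +ℙ (q +ℙ 0ℙ))
      tail : List Constraint
      tail = when (rP₃ ∈F?) (i ∷ [] , 0ℙ) ++ when (bP₃ ∈F?) (i ∷ [] , 1ℙ)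
      sound : ∀ c d → y i ≡ parity c → parity c +ℙ (parity d +ℙ 0ℙ) ≡ 0ℙ → All (Holds y) tail → ¬ Forbidden (just c) (just d) nothing
      -- Mixed colours are absent because the parity equation would read 1ℙ ≡ 0ℙ.
      sound red  red  yi _ hs f = 1≢0 (trans (sym (cong (_+ℙ 0ℙ) yi)) (when⁻ (rP₃ ∈F?) (++⁻ˡ (when (rP₃ ∈F?) _) hs) f))
      sound blue blue yi _ hs f = 1≢0 (trans (sym (when⁻ (bP₃ ∈F?) (++⁻ʳ (when (rP₃ ∈F?) _) hs) f)) (cong (_+ℙ 0ℙ) yi))
      complete : ∀ c d → y i ≡ parity c → y i +ℙ (y j +ℙ 0ℙ) ≡ parity c +ℙ (parity d +ℙ 0ℙ) →
                 ¬ Forbidden (just c) (just d) nothing → All (Holds y) ((i ∷ j ∷ [] , 0ℙ) ∷ tail)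
      complete red  red  yi eq ¬f =
        eq ∷ ++⁺ (when⁺ (rP₃ ∈F?) (λ f → ⊥-elim (¬f f))) (when⁺ (bP₃ ∈F?) (λ _ → cong (_+ℙ 0ℙ) yi))
      complete red  blue yi eq ¬f = ⊥-elim (¬f rb)
      complete blue red  yi eq ¬f = ⊥-elim (¬f (brP₃∈F rb))
      complete blue blue yi eq ¬f =
        eq ∷ ++⁺ (when⁺ (rP₃ ∈F?) (λ _ → cong (_+ℙ 0ℙ) yi)) (when⁺ (bP₃ ∈F?) (λ f → ⊥-elim (¬f f)))
    pairWith-correct (inj₂ (rr , bb)) i j c d yi yj = mk⇔ (λ { (h ∷ hs) → sound c d (trans (sym (value yi yj)) h) hs }) (complete c d (value yi yj))
      where
      value : ∀ {c d} → y i ≡ parity c → y j ≡ parity d → y i +ℙ (y j +ℙ 0ℙ) ≡ parity c +ℙ (parity d +ℙ 0ℙ)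
      value = cong₂ (λ p q → p +ℙ (q +ℙ 0ℙ))
      tail : List Constraint
      tail = when (rbP₃ ∈F?) ([] , 1ℙ)
      sound : ∀ c d → parity c +ℙ (parity d +ℙ 0ℙ) ≡ 1ℙ → All (Holds y) tail → ¬ Forbidden (just c) (just d) nothing
      sound red  blue _ hs f = 1≢0 (sym (when⁻ (rbP₃ ∈F?) hs f))
      sound blue red  _ hs f = 1≢0 (sym (when⁻ (rbP₃ ∈F?) hs
        (∈≅-resp {K = standard (just blue) (just red) nothing} (swap₀₂ (just red) (just blue) nothing) f)))
      complete : ∀ c d → y i +ℙ (y j +ℙ 0ℙ) ≡ parity c +ℙ (parity d +ℙ 0ℙ) →
                 ¬ Forbidden (just c) (just d) nothing → All (Holds y) ((i ∷ j ∷ [] , 1ℙ) ∷ tail)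
      complete red  red  eq ¬f = ⊥-elim (¬f rr)
      complete red  blue eq ¬f = eq ∷ when⁺ (rbP₃ ∈F?) (λ f → ⊥-elim (¬f f))
      complete blue red  eq ¬f = eq ∷ when⁺ (rbP₃ ∈F?) (λ f → ⊥-elim (¬f (brP₃∈F f)))
      complete blue blue eq ¬f = ⊥-elim (¬f bb)

    triangle-correct : ∀ c d e → y 0F ≡ parity c → y 1F ≡ parity d → y 2F ≡ parity e →
      All (Holds y) ((0F ∷ 1F ∷ 2F ∷ [] , τ) ∷ []) ⇔ (¬ Forbidden (just c) (just d) (just e))
    triangle-correct c d e p q r = mk⇔
      (λ { (h ∷ []) f → does-transfer forbidden? odd? (forbiddenTriangle? τ c d e) (to (triangles K isTriangle) f) (trans (sym value) h) })
      (λ ¬f → trans value (decidable-stable (sum ℙ.≟ τ) (λ odd →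
        ¬f (from (triangles K isTriangle) (does-transfer odd? forbidden? (sym (forbiddenTriangle? τ c d e)) odd)))) ∷ [])
      where
      K : ColouredGraph 3
      K = standard (just c) (just d) (just e)
      sum : Parity
      sum = parity c +ℙ (parity d +ℙ (parity e +ℙ 0ℙ))
      forbidden? = K ∈≅? forbiddenTriangles τ
      odd? = ¬? (sum ℙ.≟ τ)
      value : y 0F +ℙ (y 1F +ℙ (y 2F +ℙ 0ℙ)) ≡ sum
      value rewrite p | q | r = refl
      isTriangle : IsTriangle K
      isTriangle 0F 0F u≢v = u≢v refl
      isTriangle 0F 1F _   = tt
      isTriangle 0F 2F _   = tt
      isTriangle 1F 0F _   = tt
      isTriangle 1F 1F u≢v = u≢v refl
      isTriangle 1F 2F _   = tt
      isTriangle 2F 0F _   = tt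
      isTriangle 2F 1F _   = tt
      isTriangle 2F 2F u≢v = u≢v refl

    permuted : ∀ {a b c a′ b′ c′} {A : Set} → standard a b c ≈ standard a′ b′ c′ →
      A ⇔ (¬ Forbidden a b c) → A ⇔ (¬ Forbidden a′ b′ c′)
    permuted {a} {b} {c} {a′} {b′} {c′} π h = mk⇔
      (λ x f → to h x (∈≅-resp {K = standard a′ b′ c′} π f))
      (λ ¬f → from h (λ f → ¬f (∈≅-resp {K = standard a b c} (≈-sym {H = standard a b c} {standard a′ b′ c′} π) f)))

    constraints-correct : ∀ a b c → Agrees a (y 0F) → Agrees b (y 1F) → Agrees c (y 2F) →
      All (Holds y) (constraints (is-just a) (is-just b) (is-just c)) ⇔ (¬ Forbidden a b c)
    constraints-correct nothing  nothing  nothing  _ _ _ = none-correct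
    constraints-correct (just c) nothing  nothing  p _ _ = single-correct 0F c p
    constraints-correct nothing  (just c) nothing  _ p _ = permuted (swap₀₂ (just c) nothing nothing) (single-correct 1F c p)
    constraints-correct nothing  nothing  (just c) _ _ p = permuted (swap₁₂ (just c) nothing nothing) (single-correct 2F c p)
    constraints-correct (just c) (just d) nothing  p q _ = pairWith-correct paths 0F 1F c d p q
    constraints-correct (just c) nothing  (just d) p _ q = permuted (swap₀₁ (just c) (just d) nothing) (pairWith-correct paths 0F 2F c d p q)
    -- The edges are listed as uw, vw because a single transposition then leads to the path 0 - 1 -
    -- 2; the other order would need a 3-cycle.
    constraints-correct nothing  (just c) (just d) _ p q = permuted (swap₁₂ (just d) (just c) nothing) (pairWith-correct paths 2F 1F d c q p)
    constraints-correct (just c) (just d) (just e) p q r = triangle-correct c d e p q r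

  -- The reduction and its correctness

  open Generator constraints using (generator)

  system : ∃ Graph → LinearSystem
  system (n , G) = systemOf generator (contents (encodeGraph (n , G))) n

  system-polynomialTime : PolynomialTime encodeGraph encodeSystem system
  system-polynomialTime = word-polynomialTime encodeGraph encodeSystem system (systemBits generator) λ { (n , G) →
    trans (cong (λ L → word (contents (encodeGraph (n , G))) (systemBits generator) (L ∷ [])) (length-encodeGraph G))
          (word-systemBits generator (contents (encodeGraph (n , G))) n) }

  module _ {n : ℕ} (G : Graph n) where

    open TripleSystem G (contents (encodeGraph (n , G))) (contents-encodeGraph G) constraints

    Represents : Vec Parity (n * n) → Colouring G → Set
    Represents x c = ∀ u v → Agrees (entry (G , c) u v) (edgeVar x u v)

    tripleHolds⇔ : ∀ {x c} → Represents x c → ∀ u v w →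
      TripleHolds x u v w ⇔ (¬ Forbidden (entry (G , c) u v) (entry (G , c) v w) (entry (G , c) u w))
    tripleHolds⇔ {x} {c} agrees u v w = subst (λ cs → All (Holds y) cs ⇔
        (¬ Forbidden (entry H u v) (entry H v w) (entry H u w))) bits
      (constraints-correct y (entry H u v) (entry H v w) (entry H u w) (agrees u v) (agrees v w) (agrees u w))
      where
      H : ColouredGraph n
      H = G , c
      y : Fin 3 → Parity
      y = triple (edgeVar x u v) (edgeVar x v w) (edgeVar x u w)
      is-just-entry : ∀ i j → is-just (entry H i j) ≡ adj G i j
      is-just-entry i j = is-just-entryOf (adj G i j) (colour c i j)
      bits : constraints (is-just (entry H u v)) (is-just (entry H v w)) (is-just (entry H u w)) ≡
             constraints (adj G u v) (adj G v w) (adj G u w)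
      bits rewrite is-just-entry u v | is-just-entry v w | is-just-entry u w = refl

    solution⇒colouring : Solvable (system (n , G)) → HasFreeColouring F G
    solution⇒colouring (x , solves) = c , from (Free⇔TripleFree F (G , c)) λ u v w u≢v v≢w u≢w →
      to (tripleHolds⇔ {x} {c} agrees u v w) (proj₂ (holds u v w) u≢v v≢w u≢w)
      where
      holds : ∀ u v w → BodyHolds x u v w
      holds = to (All-generator x) solves
      edgeVar-sym : ∀ u v → edgeVar x u v ≡ edgeVar x v u
      -- Symmetry does not depend on the third vertex; `u` serves, so no third distinct vertex has
      -- to exist.
      edgeVar-sym u v = ℙ.+-cancelʳ-≡ (edgeVar x v u) _ _ (trans (proj₁ (holds u v u)) (sym (ℙ.p+p≡0ℙ (edgeVar x v u))))
      c : Colouring G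
      c = record
        { colour     = λ u v _ → paint (edgeVar x u v)
        ; colour-sym = λ u v _ _ → cong paint (edgeVar-sym u v)
        }
      agrees-entryOf : ∀ b p → Agrees (entryOf b λ _ → paint p) p
      agrees-entryOf false p = tt
      agrees-entryOf true  p = sym (parity-paint p)
      agrees : Represents x c
      agrees u v = agrees-entryOf (adj G u v) (edgeVar x u v)

    colouring⇒solution : HasFreeColouring F G → Solvable (system (n , G))
    colouring⇒solution (c , free) = x , from (All-generator x) λ u v w →
      trans (cong₂ _+ℙ_ (edgeVar-x u v) (trans (edgeVar-x v u) (cong value (entry-sym H v u)))) (ℙ.p+p≡0ℙ (value (entry H u v))) ,
      λ u≢v v≢w u≢w → from (tripleHolds⇔ {x} {c} agrees u v w) (to (Free⇔TripleFree F H) free u v w u≢v v≢w u≢w)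
      where
      H : ColouredGraph n
      H = G , c
      -- Non-edges and the diagonal get 0ℙ; a common value for both orientations is all that the
      -- symmetry equations ask there.
      value : Maybe Colour → Parity
      value = maybe′ parity 0ℙ
      valuation : ℕ → Parity
      valuation k with k <? n * n
      -- The number n * u + v is that of `combine u v`, which `remQuot` inverts.
      ... | yes k<n² = uncurry (λ u v → value (entry H u v)) (remQuot n (fromℕ< k<n²))
      ... | no _     = 0ℙ
      x : Vec Parity (n * n)
      x = tabulate↓ (n * n) valuation
      valuation-combine : ∀ u v → valuation (toℕ (combine u v)) ≡ value (entry H u v)
      valuation-combine u v with toℕ (combine u v) <? n * n
      ... | yes k<n² = cong (uncurry λ u v → value (entry H u v))
                         (trans (cong (remQuot n) (Fin.fromℕ<-toℕ (combine u v) k<n²)) (Fin.remQuot-combine u v))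
      ... | no k≮n²  = ⊥-elim (k≮n² (Fin.toℕ<n (combine u v)))
      edgeVar-x : ∀ u v → edgeVar x u v ≡ value (entry H u v)
      edgeVar-x u v = trans (cong (at x) (sym (Fin.toℕ-combine u v)))
        (trans (at-tabulate↓ valuation (Fin.toℕ<n (combine u v))) (valuation-combine u v))
      agrees-value : ∀ a {p} → p ≡ value a → Agrees a p
      agrees-value nothing  eq = tt
      agrees-value (just _) eq = eq
      agrees : Represents x c
      agrees u v = agrees-value (entry H u v) (edgeVar-x u v)

lemma37 : (F : List (ColouredGraph 3)) →
    (rbP₃ ∈≅ F) ⊎ ((rP₃ ∈≅ F) × (bP₃ ∈≅ F)) →
    (TrianglesOf F Are (rK₃ ∷ rbbK₃ ∷ [])) ⊎ (TrianglesOf F Are (bK₃ ∷ rrbK₃ ∷ [])) →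
    Σ (∃ Graph → LinearSystem) λ system →
    PolynomialTime encodeGraph encodeSystem system ×
    (∀ n (G : Graph n) → Solvable (system (n , G)) ⇔ HasFreeColouring F G)
lemma37 F paths triangles =
  system , system-polynomialTime , λ n G → mk⇔ (solution⇒colouring G) (colouring⇒solution G)
  where
  choose : (TrianglesOf F Are oddTriangles) ⊎ (TrianglesOf F Are evenTriangles) →
           ∃ λ τ → TrianglesOf F Are forbiddenTriangles τ
  choose (inj₁ odd)  = 0ℙ , odd
  choose (inj₂ even) = 1ℙ , even
  open LocalConstraints F (_∈≅? F) paths (proj₁ (choose triangles)) (proj₂ (choose triangles))
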